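{- Let $P$ be the level poset of the matrix $$M=\begin{pmatrix}1&1&1&0\\1&0&1&1\\0&1&0&1\\1&0&1&1\end{pmatrix}$$ with rows and columns indexed by $\{1,2,3,4\}$; this is a level Eulerian poset. For every $m\ge 0$, the $\mathbf{c}\mathbf{d}$-index of the interval $[(1,0),(1,m+1)]$ of $P$ is the sum of all $\mathbf{c}\mathbf{d}$-monomials of degree $m$.
   Context: Level poset: for a $0/1$ square matrix $M$ with rows and columns indexed by a finite nonempty set $V$, the level poset of $M$ is the poset on $V\times\mathbb{Z}$ with $(u,i)<(v,j)$ if and only if $i<j$ and $(M^{j-i})_{u,v}>0$; the second coordinate is its rank function. A finite graded poset (with minimum, maximum and rank function $\rho$) is Eulerian if every interval $[x,y]$ in it of rank at least $1$ satisfies $\sum_{x\le z\le y}(-1)^{\rho(z)}=0$. A level poset is level Eulerian if every one of its intervals is Eulerian. $\mathbf{a}\mathbf{b}$-index: for a finite graded poset $Q$ of rank $m+1$ with minimum $\hat0$, maximum $\hat1$ and rank function $\rho$, and a chain $c=\{\hat0=x_0<x_1<\cdots<x_{k+1}=\hat1\}$, put $$\operatorname{wt}(c)=(\mathbf{a}-\mathbf{b})^{\rho(x_0,x_1)-1}\cdot\mathbf{b}\cdot(\mathbf{a}-\mathbf{b})^{\rho(x_1,x_2)-1}\cdot\mathbf{b}\cdots\mathbf{b}\cdot(\mathbf{a}-\mathbf{b})^{\rho(x_k,x_{k+1})-1},$$ where $\rho(x,y)=\rho(y)-\rho(x)$ and $\mathbf{a},\mathbf{b}$ are non-commuting variables.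 Then $\Psi(Q)=\sum_c\operatorname{wt}(c)$, summed over all chains $c$ containing $\hat0$ and $\hat1$. For Eulerian $Q$, $\Psi(Q)$ can be written (uniquely) as a non-commutative polynomial in $\mathbf{c}=\mathbf{a}+\mathbf{b}$ (degree 1) and $\mathbf{d}=\mathbf{a}\mathbf{b}+\mathbf{b}\mathbf{a}$ (degree 2); this polynomial is the $\mathbf{c}\mathbf{d}$-index of $Q$. A $\mathbf{c}\mathbf{d}$-monomial of degree $m$ is a word in $\mathbf{c},\mathbf{d}$ whose total degree is $m$. -}

module Defs where

import Algebra.Properties.Semiring.Sum as SemiringSum
open import Data.Fin.Base using (Fin; zero; suc)
import Data.Fin.Properties as Fin
open import Data.Integer.Base as ℤ using (ℤ; +_; 0ℤ; 1ℤ; -1ℤ)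
import Data.Integer.Properties as ℤ
open import Data.Irrelevant using ([_])
open import Data.List.Base as List
  using (List; []; _∷_; _++_; filter; foldr; concatMap; upTo; allFin;
         cartesianProduct; cartesianProductWith)
open import Data.List.Membership.Propositional using (_∈_)
open import Data.List.Membership.Propositional.Properties
  using (∈-map⁺; ∈-upTo⁺; ∈-allFin; ∈-cartesianProduct⁺)
open import Data.List.Properties using (≡-dec)
open import Data.List.Relation.Unary.All using (All; []; _∷_)
open import Data.List.Relation.Unary.AllPairs using ([]; _∷_)
open import Data.List.Relation.Unary.Any using (here; there)
open import Data.List.Relation.Unary.Linked using (Linked; linked?)
open import Data.List.Relation.Unary.Unique.Propositional using (Unique)
import Data.List.Relation.Unary.Unique.Propositional.Properties as Unique
open import Data.Nat.Base as ℕ using (ℕ; zero; suc; _∸_)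
import Data.Nat.Properties as ℕ
open import Data.Product.Base using (∃-syntax; _×_; _,_; proj₁; proj₂)
import Data.Product.Properties as Product
open import Data.Refinement.Base using (Refinement-syntax; value; _,_)
import Data.Refinement.Properties as Refinement
open import Data.Sum.Base using (inj₁; inj₂)
open import Data.Vec.Base using (Vec; []; _∷_; lookup)
import Relation.Binary.Construct.StrictToNonStrict as NonStrict
open import Relation.Binary.Definitions using (DecidableEquality; Decidable)
open import Relation.Binary.PropositionalEquality
open import Relation.Binary.Structures using (IsDecStrictPartialOrder)
open import Relation.Nullary using (yes; no; ¬_; contradiction)
open import Relation.Nullary.Decidable using (_×-dec_; recompute)
open import Relation.Unary using () renaming (Decidable to Decidable₁)

-- All length-k words over the letters xs.
words : {A : Set} → ℕ → List A → List (List A)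
words zero    xs = [] ∷ []
words (suc k) xs = cartesianProductWith _∷_ xs (words k xs)

sumℤ : List ℤ → ℤ
sumℤ = foldr ℤ._+_ 0ℤ

------------------------------------------------------------------------
-- Non-commutative polynomials with integer coefficients

-- A polynomial is a formal sum of coefficient-word pairs; words may be
-- repeated, so equality of polynomials is _≈_ below.
Poly : Set → Set
Poly X = List (ℤ × List X)

module _ {X : Set} where

  infixl 6 _+ₚ_ _-ₚ_
  infixl 7 _*ₚ_
  infixr 8 _^ₚ_

  monomial : List X → Poly X
  monomial w = (1ℤ , w) ∷ []

  var : X → Poly X
  var x = monomial (x ∷ [])

  scale : ℤ → Poly X → Poly X
  scale k = List.map λ (l , w) → k ℤ.* l , w

  0ₚ 1ₚ : Poly X
  0ₚ = []
  1ₚ = monomial []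

  _+ₚ_ _-ₚ_ _*ₚ_ : Poly X → Poly X → Poly X
  p +ₚ q = p ++ q
  p -ₚ q = p +ₚ scale -1ℤ q
  p *ₚ q = cartesianProductWith (λ (k , v) (l , w) → k ℤ.* l , v ++ w) p q

  _^ₚ_ : Poly X → ℕ → Poly X
  p ^ₚ zero  = 1ₚ
  p ^ₚ suc n = p *ₚ (p ^ₚ n)

  sumₚ : List (Poly X) → Poly X
  sumₚ = foldr _+ₚ_ 0ₚ

  module Coefficients (_≟_ : DecidableEquality X) where

    coeff : Poly X → List X → ℤ
    coeff p w = sumℤ (List.map proj₁ (filter (λ (_ , v) → ≡-dec _≟_ v w) p))

    infix 4 _≈_
    _≈_ : Poly X → Poly X → Set
    p ≈ q = ∀ w → coeff p w ≡ coeff q w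

-- The ring homomorphism extending f.
substitute : {X Y : Set} → (X → Poly Y) → Poly X → Poly Y
substitute f p =
  sumₚ (List.map (λ (k , w) → scale k (foldr _*ₚ_ 1ₚ (List.map f w))) p)

data AB : Set where
  a b : AB

data CD : Set where
  c d : CD

_≟AB_ : DecidableEquality AB
a ≟AB a = yes refl
a ≟AB b = no λ ()
b ≟AB a = no λ ()
b ≟AB b = yes refl

open Coefficients _≟AB_ public

a-b^ : ℕ → Poly AB
a-b^ n = (var a -ₚ var b) ^ₚ n

expandCD : CD → Poly AB
expandCD c = var a +ₚ var b
expandCD d = var a *ₚ var b +ₚ var b *ₚ var a

expand : Poly CD → Poly AB
expand = substitute expandCD

degree : List CD → ℕ
degree []      = 0
degree (c ∷ w) = 1 ℕ.+ degree w
degree (d ∷ w) = 2 ℕ.+ degree w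

-- A word of degree m has length at most m.
cdMonomials : ℕ → List (List CD)
cdMonomials m =
  filter (λ w → degree w ℕ.≟ m)
         (concatMap (λ k → words k (c ∷ d ∷ [])) (upTo (suc m)))

sumOfCDMonomials : ℕ → Poly CD
sumOfCDMonomials m = sumₚ (List.map monomial (cdMonomials m))

------------------------------------------------------------------------
-- Finite graded posets with minimum and maximum

record FiniteGradedPoset : Set₁ where
  infix 4 _<_ _≤_ _≤?_
  field
    Carrier                 : Set
    _<_                     : Carrier → Carrier → Set
    isDecStrictPartialOrder : IsDecStrictPartialOrder _≡_ _<_

  _≤_ : Carrier → Carrier → Set
  _≤_ = NonStrict._≤_ _≡_ _<_

  _⋖_ : Carrier → Carrier → Set
  x ⋖ y = x < y × (∀ z → ¬ (x < z × z < y))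

  field
    elements : List Carrier
    unique   : Unique elements
    complete : ∀ x → x ∈ elements

    0̂ 1̂     : Carrier
    minimum : ∀ x → 0̂ ≤ x
    maximum : ∀ x → x ≤ 1̂

    ρ      : Carrier → ℕ
    ρ-0̂    : ρ 0̂ ≡ 0
    ρ-mono : ∀ {x y} → x < y → ρ x ℕ.< ρ y
    ρ-⋖    : ∀ {x y} → x ⋖ y → ρ y ≡ suc (ρ x)

  open IsDecStrictPartialOrder isDecStrictPartialOrder public
    using (_≟_; _<?_)

  _≤?_ : Decidable _≤_
  _≤?_ = NonStrict.decidable _≡_ _<_ _≟_ _<?_

module _ (Q : FiniteGradedPoset) where
  open FiniteGradedPoset Q

  Eulerian : Set
  Eulerian = ∀ {x y} → x ≤ y → 1 ℕ.≤ ρ y ∸ ρ x →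
    sumℤ (List.map (λ z → -1ℤ ℤ.^ ρ z)
      (filter (λ z → (x ≤? z) ×-dec (z ≤? y)) elements)) ≡ 0ℤ

  -- A chain 0̂ = x₀ < x₁ < ⋯ < xₖ < xₖ₊₁ = 1̂ is represented by x₁ ∷ ⋯ ∷ xₖ ∷ [].
  IsChain : List Carrier → Set
  IsChain xs = Linked _<_ (0̂ ∷ xs ++ 1̂ ∷ [])

  isChain? : Decidable₁ IsChain
  isChain? xs = linked? _<?_ (0̂ ∷ xs ++ 1̂ ∷ [])

  -- Since ρ strictly increases along a chain, k < ρ 1̂.
  chains : List (List Carrier)
  chains =
    filter isChain?
           (concatMap (λ k → words k elements) (upTo (ρ 1̂)))

  wtFrom : Carrier → List Carrier → Poly AB
  wtFrom x []       = a-b^ (ρ 1̂ ∸ ρ x ∸ 1)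
  wtFrom x (y ∷ ys) = a-b^ (ρ y ∸ ρ x ∸ 1) *ₚ var b *ₚ wtFrom y ys

  wt : List Carrier → Poly AB
  wt = wtFrom 0̂

  Ψ : Poly AB
  Ψ = sumₚ (List.map wt chains)

  IsCDIndex : Poly CD → Set
  IsCDIndex Φ = expand Φ ≈ Ψ

------------------------------------------------------------------------
-- Square matrices

Matrix : ℕ → Set
Matrix n = Fin n → Fin n → ℕ

open SemiringSum ℕ.+-*-semiring using (sum)

module _ {n : ℕ} where

  identity : Matrix n
  identity u v with u Fin.≟ v
  ... | yes _ = 1
  ... | no  _ = 0

  infixl 7 _⊗_
  _⊗_ : Matrix n → Matrix n → Matrix n
  (A ⊗ B) u w = sum λ v → A u v ℕ.* B v w

  infixr 8 _^ᴹ_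
  _^ᴹ_ : Matrix n → ℕ → Matrix n
  M ^ᴹ zero  = identity
  M ^ᴹ suc k = M ⊗ M ^ᴹ k

sum-pos⁺ : ∀ {n} (f : Fin n → ℕ) v → 0 ℕ.< f v → 0 ℕ.< sum f
sum-pos⁺ f zero    p = ℕ.≤-trans p (ℕ.m≤m+n _ _)
sum-pos⁺ f (suc v) p =
  ℕ.≤-trans (sum-pos⁺ (λ u → f (suc u)) v p) (ℕ.m≤n+m _ (f zero))

sum-pos⁻ : ∀ {n} (f : Fin n → ℕ) → 0 ℕ.< sum f → ∃[ v ] 0 ℕ.< f v
sum-pos⁻ {suc n} f p with f zero in eq
... | suc _ = zero , subst (0 ℕ.<_) (sym eq) ℕ.z<s
... | zero with sum-pos⁻ (λ u → f (suc u)) p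
...   | v , q = suc v , q

*-pos⁻ : ∀ m k → 0 ℕ.< m ℕ.* k → 0 ℕ.< m × 0 ℕ.< k
*-pos⁻ (suc m) (suc k) p = ℕ.z<s , ℕ.z<s
*-pos⁻ (suc m) zero    p = contradiction (subst (0 ℕ.<_) (ℕ.*-zeroʳ m) p) λ ()

module _ {n} (A B : Matrix n) where

  ⊗-pos⁺ : ∀ {u v w} → 0 ℕ.< A u v → 0 ℕ.< B v w → 0 ℕ.< (A ⊗ B) u w
  ⊗-pos⁺ {v = v} p q = sum-pos⁺ _ v (ℕ.*-mono-≤ p q)

  ⊗-pos⁻ : ∀ {u w} → 0 ℕ.< (A ⊗ B) u w → ∃[ v ] 0 ℕ.< A u v × 0 ℕ.< B v w
  ⊗-pos⁻ p with sum-pos⁻ _ p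
  ... | v , q = v , *-pos⁻ _ _ q

module _ {n} (M : Matrix n) where

  identity-pos : ∀ u → 0 ℕ.< identity {n} u u
  identity-pos u with u Fin.≟ u
  ... | yes _  = ℕ.z<s
  ... | no u≢u = contradiction refl u≢u

  ^-trans : ∀ k l {u v w} → 0 ℕ.< (M ^ᴹ k) u v → 0 ℕ.< (M ^ᴹ l) v w →
            0 ℕ.< (M ^ᴹ (k ℕ.+ l)) u w
  ^-trans zero l {u} {v} p q with u Fin.≟ v
  ... | yes refl = q
  ^-trans (suc k) l p q with ⊗-pos⁻ M (M ^ᴹ k) p
  ... | t , r , s = ⊗-pos⁺ M (M ^ᴹ (k ℕ.+ l)) r (^-trans k l s q)

  ^-one : ∀ {u v} → 0 ℕ.< M u v → 0 ℕ.< (M ^ᴹ 1) u v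
  ^-one {v = v} p = ⊗-pos⁺ M identity p (identity-pos v)

------------------------------------------------------------------------
-- Level posets

-- The index set V is Fin n. Nothing below needs the entries of M to be 0 or 1.
module LevelPoset {n : ℕ} (M : Matrix n) where

  infix 4 _<_ _≤_ _<?_ _≤?_

  Element : Set
  Element = Fin n × ℤ

  _<_ : Element → Element → Set
  (u , i) < (v , j) = i ℤ.< j × 0 ℕ.< (M ^ᴹ ℤ.∣ j ℤ.- i ∣) u v

  _≤_ : Element → Element → Set
  _≤_ = NonStrict._≤_ _≡_ _<_

  _≟_ : DecidableEquality Element
  _≟_ = Product.≡-dec Fin._≟_ ℤ._≟_

  _<?_ : Decidable _<_
  (u , i) <? (v , j) = (i ℤ.<? j) ×-dec (0 ℕ.<? (M ^ᴹ ℤ.∣ j ℤ.- i ∣) u v)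

  _≤?_ : Decidable _≤_
  _≤?_ = NonStrict.decidable _≡_ _<_ _≟_ _<?_

  shift-∣-∣ : ∀ i k → ℤ.∣ (i ℤ.+ + k) ℤ.- i ∣ ≡ k
  shift-∣-∣ i k = cong ℤ.∣_∣ (begin
    (i ℤ.+ + k) ℤ.- i         ≡⟨ cong (ℤ._- i) (ℤ.+-comm i (+ k)) ⟩
    (+ k ℤ.+ i) ℤ.- i         ≡⟨ ℤ.+-assoc (+ k) i (ℤ.- i) ⟩
    + k ℤ.+ (i ℤ.- i)         ≡⟨ cong (λ z → + k ℤ.+ z) (ℤ.+-inverseʳ i) ⟩
    + k ℤ.+ 0ℤ                ≡⟨ ℤ.+-identityʳ (+ k) ⟩
    + k                       ∎)
    where open ≡-Reasoning

  ≤-shift : ∀ {i j} → i ℤ.≤ j → j ≡ i ℤ.+ + ℤ.∣ j ℤ.- i ∣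
  ≤-shift {i} {j} i≤j = begin
    j                          ≡⟨ ℤ.+-identityˡ j ⟨
    0ℤ ℤ.+ j                   ≡⟨ cong (ℤ._+ j) (ℤ.+-inverseʳ i) ⟨
    (i ℤ.- i) ℤ.+ j            ≡⟨ ℤ.+-assoc i (ℤ.- i) j ⟩
    i ℤ.+ (ℤ.- i ℤ.+ j)        ≡⟨ cong (λ z → i ℤ.+ z) (ℤ.+-comm (ℤ.- i) j) ⟩
    i ℤ.+ (j ℤ.- i)            ≡⟨ cong (λ z → i ℤ.+ z) (ℤ.0≤i⇒+∣i∣≡i (ℤ.i≤j⇒0≤j-i i≤j)) ⟨
    i ℤ.+ + ℤ.∣ j ℤ.- i ∣      ∎
    where open ≡-Reasoning

  <-shift : ∀ i k → i ℤ.< i ℤ.+ + suc k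
  <-shift i k = subst (ℤ._< i ℤ.+ + suc k) (ℤ.+-identityʳ i)
                      (ℤ.+-monoʳ-< i (ℤ.+<+ ℕ.z<s))

  <⁺ : ∀ {u v i} k → 0 ℕ.< (M ^ᴹ suc k) u v → (u , i) < (v , i ℤ.+ + suc k)
  <⁺ {u} {v} {i} k p =
    <-shift i k , subst (λ l → 0 ℕ.< (M ^ᴹ l) u v) (sym (shift-∣-∣ i (suc k))) p

  <⁻ : ∀ {u v i j} → (u , i) < (v , j) →
       ∃[ k ] j ≡ i ℤ.+ + suc k × 0 ℕ.< (M ^ᴹ suc k) u v
  <⁻ {i = i} {j} (i<j , p) with ℤ.∣ j ℤ.- i ∣ | ≤-shift (ℤ.<⇒≤ i<j)
  ... | zero  | eq =
    contradiction (trans (sym (ℤ.+-identityʳ i)) (sym eq)) (ℤ.<⇒≢ i<j)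
  ... | suc k | eq = k , eq , p

  shift-injective : ∀ i {k l} → i ℤ.+ + k ≡ i ℤ.+ + l → k ≡ l
  shift-injective i {k} {l} eq = begin
    k                          ≡⟨ shift-∣-∣ i k ⟨
    ℤ.∣ (i ℤ.+ + k) ℤ.- i ∣    ≡⟨ cong (λ j → ℤ.∣ j ℤ.- i ∣) eq ⟩
    ℤ.∣ (i ℤ.+ + l) ℤ.- i ∣    ≡⟨ shift-∣-∣ i l ⟩
    l                          ∎
    where open ≡-Reasoning

  +-shift : ∀ i k l → (i ℤ.+ + k) ℤ.+ + l ≡ i ℤ.+ + (k ℕ.+ l)
  +-shift i k l = ℤ.+-assoc i (+ k) (+ l)

  <-trans : ∀ {x y z} → x < y → y < z → x < z
  <-trans {_ , i} x<y y<z with <⁻ x<y | <⁻ y<z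
  ... | k , refl , p | l , refl , q =
    subst (λ j → _ < (_ , j)) (sym (+-shift i (suc k) (suc l)))
          (<⁺ (k ℕ.+ suc l) (^-trans M (suc k) (suc l) p q))

  <-irrefl : ∀ {x} → ¬ x < x
  <-irrefl (i<i , _) = ℤ.<-irrefl refl i<i

  ≤-trans : ∀ {x y z} → x ≤ y → y ≤ z → x ≤ z
  ≤-trans = NonStrict.trans _≡_ _<_ isEquivalence (resp₂ _<_) <-trans

  ≤⇒level≤ : ∀ {x y} → x ≤ y → proj₂ x ℤ.≤ proj₂ y
  ≤⇒level≤ (inj₁ (i<j , _)) = ℤ.<⇒≤ i<j
  ≤⇒level≤ (inj₂ refl)      = ℤ.≤-refl

  -- Covering elements lie on consecutive levels.
  cover : ∀ {x y} → x < y → (∀ z → ¬ (x < z × z < y)) →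
          proj₂ y ≡ proj₂ x ℤ.+ + 1
  cover {u , i} {v , j} x<y nothing with <⁻ x<y
  ... | zero  , refl , _ = refl
  ... | suc k , refl , p with ⊗-pos⁻ M (M ^ᴹ suc k) p
  ...   | t , q , r = contradiction
    ( <⁺ 0 (^-one M q)
    , subst (λ l → (t , i ℤ.+ + 1) < (v , l)) (+-shift i 1 (suc k)) (<⁺ k r))
    (nothing (t , i ℤ.+ + 1))

  module _ (x y : Element) where

    Between : Element → Set
    Between z = x ≤ z × z ≤ y

    between? : Decidable₁ Between
    between? z = (x ≤? z) ×-dec (z ≤? y)

    -- Membership is proof-irrelevant, so interval elements are equal as
    -- soon as the underlying poset elements are.
    Interval : Set
    Interval = [ z ∈ Element ∣ Between z ]

    restrict : List Element → List Interval
    restrict []       = []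
    restrict (z ∷ zs) with between? z
    ... | yes p = (z , [ p ]) ∷ restrict zs
    ... | no  _ = restrict zs

    candidates : List Element
    candidates = cartesianProduct (allFin n)
      (List.map (λ k → proj₂ x ℤ.+ + k) (upTo (suc ℤ.∣ proj₂ y ℤ.- proj₂ x ∣)))

    restrict-All : ∀ {z p zs} → All (λ t → ¬ z ≡ t) zs →
                   All (λ t → ¬ (z , p) ≡ t) (restrict zs)
    restrict-All []                     = []
    restrict-All {zs = t ∷ _} (z≢t ∷ q) with between? t
    ... | yes _ = (λ eq → z≢t (cong value eq)) ∷ restrict-All q
    ... | no  _ = restrict-All q

    restrict-unique : ∀ {zs} → Unique zs → Unique (restrict zs)
    restrict-unique []                = []
    restrict-unique {z ∷ _} (p ∷ ps) with between? z
    ... | yes _ = restrict-All p ∷ restrict-unique ps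
    ... | no  _ = restrict-unique ps

    restrict-∈ : ∀ {z zs} (p : Between z) → z ∈ zs → (z , [ p ]) ∈ restrict zs
    restrict-∈ {z} p (here refl) with between? z
    ... | yes _ = here refl
    ... | no ¬p = contradiction p ¬p
    restrict-∈ {zs = t ∷ _} p (there i) with between? t
    ... | yes _ = there (restrict-∈ p i)
    ... | no  _ = restrict-∈ p i

    candidates-unique : Unique candidates
    candidates-unique = Unique.cartesianProduct⁺ (Unique.allFin⁺ n)
      (Unique.map⁺ (shift-injective (proj₂ x)) (Unique.upTo⁺ _))

    ∈-candidates : ∀ {z} → Between z → z ∈ candidates
    ∈-candidates {v , j} (x≤z , z≤y) =
      ∈-cartesianProduct⁺ (∈-allFin v)
        (subst (_∈ _) (sym (≤-shift i≤j)) (∈-map⁺ _ (∈-upTo⁺ (ℕ.s≤s bound))))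
      where
      i≤j = ≤⇒level≤ x≤z
      bound : ℤ.∣ j ℤ.- proj₂ x ∣ ℕ.≤ ℤ.∣ proj₂ y ℤ.- proj₂ x ∣
      bound = ℤ.drop‿+≤+ (subst₂ ℤ._≤_
        (sym (ℤ.0≤i⇒+∣i∣≡i (ℤ.i≤j⇒0≤j-i i≤j)))
        (sym (ℤ.0≤i⇒+∣i∣≡i (ℤ.i≤j⇒0≤j-i (ℤ.≤-trans i≤j (≤⇒level≤ z≤y)))))
        (ℤ.+-monoˡ-≤ (ℤ.- proj₂ x) (≤⇒level≤ z≤y)))

    interval : x ≤ y → FiniteGradedPoset
    interval x≤y = record
      { Carrier                 = Interval
      ; _<_                     = λ s t → value s < value t
      ; isDecStrictPartialOrder = record
        { isStrictPartialOrder = record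
          { isEquivalence = isEquivalence
          ; irrefl        = λ { refl → <-irrefl }
          ; trans         = <-trans
          ; <-resp-≈      = resp₂ _
          }
        ; _≟_  = Refinement._≟_ _≟_
        ; _<?_ = λ s t → value s <? value t
        }
      ; elements = restrict candidates
      ; unique   = restrict-unique candidates-unique
      ; complete = λ s →
          let p = between s in restrict-∈ p (∈-candidates p)
      ; 0̂        = x , [ inj₂ refl , x≤y ]
      ; 1̂        = y , [ x≤y , inj₂ refl ]
      ; minimum  = λ s → ≤-lift (proj₁ (between s))
      ; maximum  = λ s → ≤-lift (proj₂ (between s))
      ; ρ        = λ s → ℤ.∣ proj₂ (value s) ℤ.- proj₂ x ∣
      ; ρ-0̂      = cong ℤ.∣_∣ (ℤ.+-inverseʳ (proj₂ x))
      ; ρ-mono   = λ {s} {t} → ρ-mono {s} {t}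
      ; ρ-⋖      = λ {s} {t} → ρ-⋖ {s} {t}
      }
      where
      between : (s : Interval) → Between (value s)
      between (z , [ p ]) = recompute (between? z) p

      ≤-lift : ∀ {s t : Interval} → value s ≤ value t →
               NonStrict._≤_ _≡_ (λ s t → value s < value t) s t
      ≤-lift (inj₁ p) = inj₁ p
      ≤-lift (inj₂ p) = inj₂ (Refinement.value-injective p)

      rank : Interval → ℕ
      rank s = ℤ.∣ proj₂ (value s) ℤ.- proj₂ x ∣

      rank-spec : ∀ s → proj₂ (value s) ≡ proj₂ x ℤ.+ + rank s
      rank-spec s = ≤-shift (≤⇒level≤ (proj₁ (between s)))

      ρ-mono : ∀ {s t} → value s < value t → rank s ℕ.< rank t
      ρ-mono {s} {t} (i<j , _) = ℤ.drop‿+<+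
        (subst₂ ℤ._<_ (nonNegative s) (nonNegative t)
                      (ℤ.+-monoˡ-< (ℤ.- proj₂ x) i<j))
        where
        nonNegative : ∀ r → proj₂ (value r) ℤ.- proj₂ x ≡ + rank r
        nonNegative r =
          sym (ℤ.0≤i⇒+∣i∣≡i (ℤ.i≤j⇒0≤j-i (≤⇒level≤ (proj₁ (between r)))))

      ρ-⋖ : ∀ {s t} →
            value s < value t × (∀ r → ¬ (value s < value r × value r < value t)) →
            rank t ≡ suc (rank s)
      ρ-⋖ {s} {t} (s<t , nothing) = trans
        (cong (λ j → ℤ.∣ j ℤ.- proj₂ x ∣) (begin
          proj₂ (value t)                 ≡⟨ cover s<t nothing′ ⟩
          proj₂ (value s) ℤ.+ + 1         ≡⟨ cong (ℤ._+ + 1) (rank-spec s) ⟩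
          proj₂ x ℤ.+ + rank s ℤ.+ + 1    ≡⟨ +-shift (proj₂ x) (rank s) 1 ⟩
          proj₂ x ℤ.+ + (rank s ℕ.+ 1)    ∎))
        (trans (shift-∣-∣ (proj₂ x) (rank s ℕ.+ 1)) (ℕ.+-comm (rank s) 1))
        where
        open ≡-Reasoning
        nothing′ : ∀ z → ¬ (value s < z × z < value t)
        nothing′ z (s<z , z<t) = nothing
          (z , [ ≤-trans (proj₁ (between s)) (inj₁ s<z)
               , ≤-trans (inj₁ z<t) (proj₂ (between t)) ])
          (s<z , z<t)

  LevelEulerian : Set
  LevelEulerian = ∀ {x y} (x≤y : x ≤ y) → Eulerian (interval x y x≤y)

------------------------------------------------------------------------
-- The indices 1, 2, 3, 4 become the elements 0, 1, 2, 3 of Fin 4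

rows : Vec (Vec ℕ 4) 4
rows = (1 ∷ 1 ∷ 1 ∷ 0 ∷ [])
     ∷ (1 ∷ 0 ∷ 1 ∷ 1 ∷ [])
     ∷ (0 ∷ 1 ∷ 0 ∷ 1 ∷ [])
     ∷ (1 ∷ 0 ∷ 1 ∷ 1 ∷ [])
     ∷ []

M : Matrix 4
M u v = lookup (lookup rows u) v

module P = LevelPoset M

bottom : P.Element
bottom = zero , 0ℤ

top : ℕ → P.Element
top m = zero , + suc m

bottom≤top : ∀ m → bottom P.≤ top m
bottom≤top m = inj₁ (ℤ.+<+ ℕ.z<s , subst (λ k → 0 ℕ.< (M ^ᴹ k) zero zero)
                                     (sym (ℕ.+-identityʳ (suc m))) (loop (suc m)))
  where
  loop : ∀ k → 0 ℕ.< (M ^ᴹ k) zero zero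
  loop zero    = ℕ.z<s
  loop (suc k) = ⊗-pos⁺ M (M ^ᴹ k) {zero} {zero} {zero} ℕ.z<s (loop k)

{-# OPTIONS --safe #-}
module Submission where

-- Splitting off the first element of a chain gives a recursion for the
-- ab-index Ψ_u(k) of [(u , 0) , (1 , k)], with t = a − b and B_j the support
-- of M^j:
--   Ψ_u(k + 1) = [M^(k+1)_{u1} > 0] t^k
--                + ∑_{j ≤ k} t^j b ∑_v (B_{j+1})_{uv} Ψ_v(k − j).
-- B₁ = M, B₂ vanishes only at (3 , 2), and B_j is the all-ones matrix J for
-- j ≥ 3.  Let F_m be the sum of the cd-monomials of degree m, so
-- F_{m+2} = c F_{m+1} + d F_m.  The solution of the recursion is
-- Ψ_u(k + 1) = F_k for u ≠ 3, Ψ₃(1) = 0 and Ψ₃(k + 2) = c F_k: with every B_j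
-- replaced by J the right-hand side would be F_{k+1} + b F_k at k + 1, and the
-- terms at the zero entries of B₁ and B₂ account for the difference.
--
-- The Eulerian sum of an interval of length at least 6 splits into its first
-- three levels, its last three, and full levels in between, each evaluated
-- directly; the shorter lengths are finitely many cases.

open import Defs
open import Data.Bool.Base using (if_then_else_; true; false)
open import Data.Fin.Base using (Fin; zero; suc)
import Data.Fin.Properties as Fin
open import Data.Integer.Base as ℤ using (ℤ; +_; 0ℤ; 1ℤ; -1ℤ)
import Data.Integer.Properties as ℤ
open import Data.Integer.Tactic.RingSolver using (solve-∀)
open import Data.List.Base as List
  using (List; []; _∷_; _++_; filter; concatMap; upTo; allFin; cartesianProductWith; foldr)
open import Data.List.Properties using (≡-dec; map-applyUpTo)
open import Data.List.Relation.Unary.Linked using ([-]; _∷_; linked?)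
open import Data.Nat.Base as ℕ using (ℕ; zero; suc; _∸_)
import Data.Nat.Properties as ℕ
open import Data.Product.Base using (∃-syntax; _×_; _,_; proj₁; proj₂)
open import Data.Refinement.Base using (value)
import Data.Refinement.Properties as Refinement
open import Data.Sum.Base using (inj₁; inj₂)
open import Function.Base using (_∘_)
open import Relation.Binary.PropositionalEquality
open import Relation.Nullary using (Dec; yes; no; does; ¬_; contradiction)
open import Relation.Nullary.Decidable using (_×-dec_; _→-dec_; from-yes)
open import Relation.Unary using () renaming (Decidable to Decidable₁)

open ≡-Reasoning

private variable
  A B C : Set

-- Finite sums over lists

∑ : List A → (A → ℤ) → ℤ
∑ xs f = sumℤ (List.map f xs)

when : {P : Set} → Dec P → ℤ → ℤ
when P? k = if does P? then k else 0ℤ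

∑-cong : ∀ (xs : List A) {f g : A → ℤ} → (∀ x → f x ≡ g x) → ∑ xs f ≡ ∑ xs g
∑-cong []       f≗g = refl
∑-cong (x ∷ xs) f≗g = cong₂ ℤ._+_ (f≗g x) (∑-cong xs f≗g)

∑-zero : ∀ (xs : List A) {f : A → ℤ} → (∀ x → f x ≡ 0ℤ) → ∑ xs f ≡ 0ℤ
∑-zero []       f≗0 = refl
∑-zero (x ∷ xs) f≗0 = cong₂ ℤ._+_ (f≗0 x) (∑-zero xs f≗0)

∑-+ : ∀ (xs : List A) (f g : A → ℤ) →
      ∑ xs (λ x → f x ℤ.+ g x) ≡ ∑ xs f ℤ.+ ∑ xs g
∑-+ []       f g = refl
∑-+ (x ∷ xs) f g = trans (cong (λ k → f x ℤ.+ g x ℤ.+ k) (∑-+ xs f g))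
                         (interchange (f x) (g x) (∑ xs f) (∑ xs g))
  where
  interchange : ∀ p q r s → (p ℤ.+ q) ℤ.+ (r ℤ.+ s) ≡ (p ℤ.+ r) ℤ.+ (q ℤ.+ s)
  interchange = solve-∀

∑-* : ∀ (xs : List A) k (f : A → ℤ) → ∑ xs (λ x → k ℤ.* f x) ≡ k ℤ.* ∑ xs f
∑-* []       k f = sym (ℤ.*-zeroʳ k)
∑-* (x ∷ xs) k f = trans (cong (λ l → k ℤ.* f x ℤ.+ l) (∑-* xs k f))
                         (sym (ℤ.*-distribˡ-+ k (f x) (∑ xs f)))

∑-swap : ∀ (xs : List A) (ys : List B) (f : A → B → ℤ) →
         ∑ xs (λ x → ∑ ys (f x)) ≡ ∑ ys (λ y → ∑ xs (λ x → f x y))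
∑-swap []       ys f = sym (∑-zero ys λ _ → refl)
∑-swap (x ∷ xs) ys f = trans (cong (ℤ._+_ (∑ ys (f x))) (∑-swap xs ys f))
                             (sym (∑-+ ys (f x) (λ y → ∑ xs (λ z → f z y))))

∑-++ : ∀ (xs ys : List A) (f : A → ℤ) → ∑ (xs ++ ys) f ≡ ∑ xs f ℤ.+ ∑ ys f
∑-++ []       ys f = sym (ℤ.+-identityˡ (∑ ys f))
∑-++ (x ∷ xs) ys f = trans (cong (ℤ._+_ (f x)) (∑-++ xs ys f))
                           (sym (ℤ.+-assoc (f x) (∑ xs f) (∑ ys f)))

∑-map : ∀ (g : A → B) xs (f : B → ℤ) → ∑ (List.map g xs) f ≡ ∑ xs (f ∘ g)
∑-map g []       f = refl
∑-map g (x ∷ xs) f = cong (ℤ._+_ (f (g x))) (∑-map g xs f)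

∑-concatMap : ∀ (g : A → List B) xs (f : B → ℤ) →
              ∑ (concatMap g xs) f ≡ ∑ xs (λ x → ∑ (g x) f)
∑-concatMap g []       f = refl
∑-concatMap g (x ∷ xs) f = trans (∑-++ (g x) (concatMap g xs) f)
                                 (cong (ℤ._+_ (∑ (g x) f)) (∑-concatMap g xs f))

∑-cartesianProductWith :
  ∀ (g : A → B → C) xs ys (f : C → ℤ) →
  ∑ (cartesianProductWith g xs ys) f ≡ ∑ xs (λ x → ∑ ys (λ y → f (g x y)))
∑-cartesianProductWith g []       ys f = refl
∑-cartesianProductWith g (x ∷ xs) ys f = trans
  (∑-++ (List.map (g x) ys) (cartesianProductWith g xs ys) f)
  (cong₂ ℤ._+_ (∑-map (g x) ys f) (∑-cartesianProductWith g xs ys f))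

∑-filter : ∀ {P : A → Set} (P? : Decidable₁ P) xs (f : A → ℤ) →
           ∑ (filter P? xs) f ≡ ∑ xs (λ x → when (P? x) (f x))
∑-filter P? []       f = refl
∑-filter P? (x ∷ xs) f with does (P? x)
... | true  = cong (ℤ._+_ (f x)) (∑-filter P? xs f)
... | false = trans (∑-filter P? xs f) (sym (ℤ.+-identityˡ _))

∑-upTo-suc : ∀ n (f : ℕ → ℤ) → ∑ (upTo (suc n)) f ≡ f 0 ℤ.+ ∑ (upTo n) (f ∘ suc)
∑-upTo-suc n f = cong (ℤ._+_ (f 0)) (trans
  (cong (λ ks → ∑ ks f) (sym (map-applyUpTo (λ k → k) suc n)))
  (∑-map suc (upTo n) f))

∑-upTo-+ : ∀ m n (f : ℕ → ℤ) →
           ∑ (upTo (m ℕ.+ n)) f ≡ ∑ (upTo m) f ℤ.+ ∑ (upTo n) (λ k → f (m ℕ.+ k))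
∑-upTo-+ zero    n f = sym (ℤ.+-identityˡ _)
∑-upTo-+ (suc m) n f = begin
  ∑ (upTo (suc (m ℕ.+ n))) f
    ≡⟨ ∑-upTo-suc (m ℕ.+ n) f ⟩
  f 0 ℤ.+ ∑ (upTo (m ℕ.+ n)) (f ∘ suc)
    ≡⟨ cong (ℤ._+_ (f 0)) (∑-upTo-+ m n (f ∘ suc)) ⟩
  f 0 ℤ.+ (∑ (upTo m) (f ∘ suc) ℤ.+ rest)
    ≡⟨ ℤ.+-assoc (f 0) _ rest ⟨
  f 0 ℤ.+ ∑ (upTo m) (f ∘ suc) ℤ.+ rest
    ≡⟨ cong (ℤ._+ rest) (∑-upTo-suc m f) ⟨
  ∑ (upTo (suc m)) f ℤ.+ rest ∎
  where rest = ∑ (upTo n) (λ k → f (suc m ℕ.+ k))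

∑-upTo-cong : ∀ n {f g : ℕ → ℤ} → (∀ {k} → k ℕ.< n → f k ≡ g k) →
              ∑ (upTo n) f ≡ ∑ (upTo n) g
∑-upTo-cong zero            f≗g = refl
∑-upTo-cong (suc n) {f} {g} f≗g = begin
  ∑ (upTo (suc n)) f            ≡⟨ ∑-upTo-suc n f ⟩
  f 0 ℤ.+ ∑ (upTo n) (f ∘ suc)  ≡⟨ cong₂ ℤ._+_ (f≗g ℕ.z<s)
                                     (∑-upTo-cong n λ k<n → f≗g (ℕ.s<s k<n)) ⟩
  g 0 ℤ.+ ∑ (upTo n) (g ∘ suc)  ≡⟨ ∑-upTo-suc n g ⟨
  ∑ (upTo (suc n)) g            ∎

-- A word of length at most `K` is empty or a letter followed by a word of length below `K`. Both
-- recursions of the proof, for cd-monomials and for chains, start from this split.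
∑-words : ∀ K (xs : List A) (f : List A → ℤ) →
  ∑ (concatMap (λ k → words k xs) (upTo (suc K))) f ≡
  f [] ℤ.+ ∑ xs (λ x → ∑ (concatMap (λ k → words k xs) (upTo K)) (f ∘ (x ∷_)))
∑-words K xs f = begin
  ∑ (concatMap ws (upTo (suc K))) f
    ≡⟨ ∑-concatMap ws (upTo (suc K)) f ⟩
  ∑ (upTo (suc K)) (λ k → ∑ (ws k) f)
    ≡⟨ ∑-upTo-suc K (λ k → ∑ (ws k) f) ⟩
  f [] ℤ.+ 0ℤ ℤ.+ ∑ (upTo K) (λ k → ∑ (ws (suc k)) f)
    ≡⟨ cong₂ ℤ._+_ (ℤ.+-identityʳ (f []))
         (trans (∑-cong (upTo K) λ k → ∑-cartesianProductWith _∷_ xs (ws k) f)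
                (∑-swap (upTo K) xs (λ k x → ∑ (ws k) (f ∘ (x ∷_))))) ⟩
  f [] ℤ.+ ∑ xs (λ x → ∑ (upTo K) (λ k → ∑ (ws k) (f ∘ (x ∷_))))
    ≡⟨ cong (ℤ._+_ (f []))
         (∑-cong xs λ x → sym (∑-concatMap ws (upTo K) (f ∘ (x ∷_)))) ⟩
  f [] ℤ.+ ∑ xs (λ x → ∑ (concatMap ws (upTo K)) (f ∘ (x ∷_))) ∎
  where
  ws : ℕ → List (List _)
  ws k = words k xs

-- Guarded summands

when-true : ∀ {P : Set} (P? : Dec P) {k} → P → when P? k ≡ k
when-true (yes _) p = refl
when-true (no ¬p) p = contradiction p ¬p

when-false : ∀ {P : Set} (P? : Dec P) {k} → ¬ P → when P? k ≡ 0ℤ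
when-false (yes p) ¬p = contradiction p ¬p
when-false (no _)  ¬p = refl

when-cong : ∀ {P Q : Set} (P? : Dec P) (Q? : Dec Q) {k l} →
            (P → Q) → (Q → P) → (P → k ≡ l) → when P? k ≡ when Q? l
when-cong (yes p) Q? P→Q Q→P eq = trans (eq p) (sym (when-true Q? (P→Q p)))
when-cong (no ¬p) Q? P→Q Q→P eq = sym (when-false Q? (¬p ∘ Q→P))

-- Serves to split a chain condition into its first step and the rest, and membership in an interval
-- into two reachability conditions.
when-× : ∀ {P Q R : Set} (P? : Dec P) (Q? : Dec Q) (R? : Dec R) {k l} →
         (P → Q × R) → (Q × R → P) → (P → k ≡ l) →
         when P? k ≡ when Q? (when R? l)
when-× (yes p) Q? R? f g eq = trans (eq p) (sym
  (trans (when-true Q? (proj₁ (f p))) (when-true R? (proj₂ (f p)))))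
when-× (no ¬p) (yes q) R? f g eq = sym (when-false R? λ r → ¬p (g (q , r)))
when-× (no ¬p) (no _)  R? f g eq = refl

when-zero : ∀ {P : Set} (P? : Dec P) → when P? 0ℤ ≡ 0ℤ
when-zero (yes _) = refl
when-zero (no _)  = refl

when-* : ∀ {P : Set} (P? : Dec P) k {l} → when P? (k ℤ.* l) ≡ k ℤ.* when P? l
when-* (yes _) k = refl
when-* (no _)  k = sym (ℤ.*-zeroʳ k)

∑-when : ∀ {P : Set} (P? : Dec P) (xs : List A) (f : A → ℤ) →
         ∑ xs (λ x → when P? (f x)) ≡ when P? (∑ xs f)
∑-when (yes _) xs f = refl
∑-when (no _)  xs f = ∑-zero xs λ _ → refl

-- Coefficient functions of ab-polynomials

-- Equality `_≈_` of formal sums is pointwise equality of these functions, so identities of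
-- polynomials become identities of integers at each word.
Series : Set
Series = List AB → ℤ

infixr 7 _◂_
-- Left multiplication by one letter: only words beginning with `x` keep a coefficient.
_◂_ : AB → Series → Series
(x ◂ X) []      = 0ℤ
(x ◂ X) (y ∷ w) = when (x ≟AB y) (X w)

prepend : List AB → Series → Series
prepend v X = foldr _◂_ X v

-- Left multiplication by a polynomial.
act : Poly AB → Series → Series
act p X w = ∑ p λ (k , v) → k ℤ.* prepend v X w

◂-cong : ∀ x {X Y : Series} → (∀ w → X w ≡ Y w) → ∀ w → (x ◂ X) w ≡ (x ◂ Y) w
◂-cong x X≗Y []      = refl
◂-cong x X≗Y (y ∷ w) = cong (when (x ≟AB y)) (X≗Y w)

prepend-cong : ∀ v {X Y : Series} → (∀ w → X w ≡ Y w) →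
               ∀ w → prepend v X w ≡ prepend v Y w
prepend-cong []      X≗Y = X≗Y
prepend-cong (x ∷ v) X≗Y = ◂-cong x (prepend-cong v X≗Y)

prepend-++ : ∀ u v (X : Series) w → prepend (u ++ v) X w ≡ prepend u (prepend v X) w
prepend-++ []      v X w = refl
prepend-++ (x ∷ u) v X w = ◂-cong x (prepend-++ u v X) w

◂-∑ : ∀ x (is : List A) (X : A → Series) w →
      (x ◂ λ w → ∑ is λ i → X i w) w ≡ ∑ is λ i → (x ◂ X i) w
◂-∑ x is X []      = sym (∑-zero is λ _ → refl)
◂-∑ x is X (y ∷ w) with does (x ≟AB y)
... | true  = refl
... | false = sym (∑-zero is λ _ → refl)

◂-* : ∀ x k (X : Series) w → (x ◂ λ w → k ℤ.* X w) w ≡ k ℤ.* (x ◂ X) w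
◂-* x k X []      = sym (ℤ.*-zeroʳ k)
◂-* x k X (y ∷ w) with does (x ≟AB y)
... | true  = refl
... | false = sym (ℤ.*-zeroʳ k)

◂-+ : ∀ x (X Y : Series) w →
      (x ◂ λ w → X w ℤ.+ Y w) w ≡ (x ◂ X) w ℤ.+ (x ◂ Y) w
◂-+ x X Y []      = refl
◂-+ x X Y (y ∷ w) with does (x ≟AB y)
... | true  = refl
... | false = refl

prepend-∑ : ∀ v (is : List A) (X : A → Series) w →
            prepend v (λ w → ∑ is λ i → X i w) w ≡ ∑ is λ i → prepend v (X i) w
prepend-∑ []      is X w = refl
prepend-∑ (x ∷ v) is X w = trans (◂-cong x (prepend-∑ v is X) w)
                                 (◂-∑ x is (λ i → prepend v (X i)) w)

prepend-* : ∀ v k (X : Series) w →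
            prepend v (λ w → k ℤ.* X w) w ≡ k ℤ.* prepend v X w
prepend-* []      k X w = refl
prepend-* (x ∷ v) k X w = trans (◂-cong x (prepend-* v k X) w)
                                (◂-* x k (prepend v X) w)

act-cong : ∀ p {X Y : Series} → (∀ w → X w ≡ Y w) → ∀ w → act p X w ≡ act p Y w
act-cong p X≗Y w = ∑-cong p λ (k , v) → cong (ℤ._*_ k) (prepend-cong v X≗Y w)

act-∑ : ∀ p (is : List A) (X : A → Series) w →
        act p (λ w → ∑ is λ i → X i w) w ≡ ∑ is λ i → act p (X i) w
act-∑ p is X w = begin
  (∑ p λ (k , v) → k ℤ.* prepend v (λ w → ∑ is λ i → X i w) w)
    ≡⟨ ∑-cong p (λ (k , v) → trans (cong (ℤ._*_ k) (prepend-∑ v is X w))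
                                   (sym (∑-* is k _))) ⟩
  (∑ p λ (k , v) → ∑ is λ i → k ℤ.* prepend v (X i) w)
    ≡⟨ ∑-swap p is _ ⟩
  (∑ is λ i → act p (X i) w) ∎

-- The zero series is an empty sum, and `act p` commutes with sums; the index type is arbitrary.
act-zero : ∀ p {X : Series} → (∀ w → X w ≡ 0ℤ) → ∀ w → act p X w ≡ 0ℤ
act-zero p X≗0 w = trans (act-cong p X≗0 w) (act-∑ {A = AB} p [] (λ _ _ → 0ℤ) w)

act-when : ∀ p {P : Set} (P? : Dec P) (X : Series) w →
           act p (λ w → when P? (X w)) w ≡ when P? (act p X w)
act-when p (yes _) X w = refl
act-when p (no _)  X w = act-zero p (λ _ → refl) w

-- Prepending a concatenation is prepending twice, and scalars and sums pass through by linearity.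
act-*ₚ : ∀ p q (X : Series) w → act (p *ₚ q) X w ≡ act p (act q X) w
act-*ₚ p q X w = begin
  act (p *ₚ q) X w
    ≡⟨ ∑-cartesianProductWith _ p q _ ⟩
  (∑ p λ (k , u) → ∑ q λ (l , v) → k ℤ.* l ℤ.* prepend (u ++ v) X w)
    ≡⟨ ∑-cong p (λ (k , u) → trans (∑-cong q λ (l , v) →
         begin
           k ℤ.* l ℤ.* prepend (u ++ v) X w
             ≡⟨ ℤ.*-assoc k l _ ⟩
           k ℤ.* (l ℤ.* prepend (u ++ v) X w)
             ≡⟨ cong (λ z → k ℤ.* (l ℤ.* z)) (prepend-++ u v X w) ⟩
           k ℤ.* (l ℤ.* prepend u (prepend v X) w)
             ≡⟨ cong (ℤ._*_ k) (prepend-* u l (prepend v X) w) ⟨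
           k ℤ.* prepend u (λ w → l ℤ.* prepend v X w) w ∎)
         (trans (∑-* q k _)
                (cong (ℤ._*_ k) (sym (prepend-∑ u q _ w))))) ⟩
  act p (act q X) w ∎

coeff-∑ : ∀ p w → coeff p w ≡ ∑ p λ (k , v) → when (≡-dec _≟AB_ v w) k
coeff-∑ p w = ∑-filter (λ (_ , v) → ≡-dec _≟AB_ v w) p proj₁

-- Prepending `v` to the coefficient function of 1 gives the indicator of the word `v`. Through
-- this, `act-*ₚ` yields the coefficients of a product.
coeff-act : ∀ p w → coeff p w ≡ act p (coeff 1ₚ) w
coeff-act p w = trans (coeff-∑ p w) (∑-cong p λ (k , v) → prepend-1 k v w)
  where
  prepend-1 : ∀ k v w → when (≡-dec _≟AB_ v w) k ≡ k ℤ.* prepend v (coeff 1ₚ) w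
  prepend-1 k []      []      = sym (ℤ.*-identityʳ k)
  prepend-1 k []      (y ∷ w) = sym (ℤ.*-zeroʳ k)
  prepend-1 k (x ∷ v) []      = sym (ℤ.*-zeroʳ k)
  prepend-1 k (x ∷ v) (y ∷ w) with x ≟AB y
  ... | no _     = sym (ℤ.*-zeroʳ k)
  ... | yes refl = prepend-1 k v w

coeff-*ₚ : ∀ p q w → coeff (p *ₚ q) w ≡ act p (coeff q) w
coeff-*ₚ p q w = begin
  coeff (p *ₚ q) w               ≡⟨ coeff-act (p *ₚ q) w ⟩
  act (p *ₚ q) (coeff 1ₚ) w      ≡⟨ act-*ₚ p q (coeff 1ₚ) w ⟩
  act p (act q (coeff 1ₚ)) w     ≡⟨ act-cong p (coeff-act q) w ⟨
  act p (coeff q) w              ∎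

coeff-sumₚ : ∀ (f : A → Poly AB) xs w →
             coeff (sumₚ (List.map f xs)) w ≡ ∑ xs λ x → coeff (f x) w
coeff-sumₚ f xs w = begin
  coeff (sumₚ (List.map f xs)) w  ≡⟨ coeff-∑ (sumₚ (List.map f xs)) w ⟩
  ∑ (concatMap f xs) _            ≡⟨ ∑-concatMap f xs _ ⟩
  (∑ xs λ x → ∑ (f x) _)          ≡⟨ ∑-cong xs (λ x → coeff-∑ (f x) w) ⟨
  (∑ xs λ x → coeff (f x) w)      ∎

coeff-scale-1 : ∀ p w → coeff (scale 1ℤ p) w ≡ coeff p w
coeff-scale-1 p w = begin
  coeff (scale 1ℤ p) w                       ≡⟨ coeff-∑ (scale 1ℤ p) w ⟩
  ∑ (scale 1ℤ p) _                           ≡⟨ ∑-map _ p _ ⟩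
  (∑ p λ (k , v) → when (v ≟ w) (1ℤ ℤ.* k))  ≡⟨ ∑-cong p (λ (k , v) →
                                                  cong (when (v ≟ w)) (ℤ.*-identityˡ k)) ⟩
  (∑ p λ (k , v) → when (v ≟ w) k)           ≡⟨ coeff-∑ p w ⟨
  coeff p w                                  ∎
  where _≟_ = ≡-dec _≟AB_

-- The sum of all cd-monomials

cdSum : ℕ → Series
cdSum zero          = coeff 1ₚ
cdSum (suc zero)    = act (expandCD c) (cdSum zero)
cdSum (suc (suc m)) w =
  act (expandCD c) (cdSum (suc m)) w ℤ.+ act (expandCD d) (cdSum m) w

expandWord : List CD → Poly AB
expandWord v = foldr _*ₚ_ 1ₚ (List.map expandCD v)

cdWords : ℕ → List (List CD)
cdWords K = concatMap (λ k → words k (c ∷ d ∷ [])) (upTo K)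

-- The length bound `K` is separate from the degree `m`, because removing a leading `d` lowers the
-- degree by 2 but the length by 1.
ofDegree : ℕ → ℕ → Series
ofDegree m K w = ∑ (cdWords K) λ v → when (degree v ℕ.≟ m) (coeff (expandWord v) w)


∑-cdWords-* : ∀ p m K w →
  ∑ (cdWords K) (λ v → when (degree v ℕ.≟ m) (coeff (p *ₚ expandWord v) w)) ≡
  act p (ofDegree m K) w
∑-cdWords-* p m K w = begin
  ∑ (cdWords K) (λ v → when (degree v ℕ.≟ m) (coeff (p *ₚ expandWord v) w))
    ≡⟨ ∑-cong (cdWords K) (λ v → trans
         (cong (when (degree v ℕ.≟ m)) (coeff-*ₚ p (expandWord v) w))
         (sym (act-when p (degree v ℕ.≟ m) (coeff (expandWord v)) w))) ⟩
  ∑ (cdWords K) (λ v → act p (λ w → when (degree v ℕ.≟ m) (coeff (expandWord v) w)) w)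
    ≡⟨ act-∑ p (cdWords K) _ w ⟨
  act p (ofDegree m K) w ∎

-- Induction on `K`, splitting words by their first letter. A word is no longer than its degree, so
-- `m < K` ensures that no word of degree `m` is cut off.
ofDegree≗cdSum : ∀ {m K} → m ℕ.< K → ∀ w → ofDegree m K w ≡ cdSum m w
ofDegree≗cdSum {m} {suc K} (ℕ.s≤s m≤K) w =
  trans
  (∑-words K (c ∷ d ∷ []) λ v → when (degree v ℕ.≟ m) (coeff (expandWord v) w))
  (go m m≤K)
  where
  noWords : ∑ (cdWords K) (λ _ → 0ℤ) ≡ 0ℤ
  noWords = ∑-zero (cdWords K) λ _ → refl

  go : ∀ m → m ℕ.≤ K →
       when (0 ℕ.≟ m) (coeff 1ₚ w) ℤ.+
       ∑ (c ∷ d ∷ []) (λ x → ∑ (cdWords K) λ v →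
         when (degree (x ∷ v) ℕ.≟ m) (coeff (expandWord (x ∷ v)) w)) ≡
       cdSum m w
  go 0 _ = trans
    (cong₂ (λ p q → coeff 1ₚ w ℤ.+ (p ℤ.+ (q ℤ.+ 0ℤ))) noWords noWords)
    (ℤ.+-identityʳ (coeff 1ₚ w))
  -- The empty word has degree 0 and a word beginning with `d` has degree at least 2, so only the
  -- letter `c` contributes.
  go 1 1≤K = trans (ℤ.+-identityˡ _) (trans
    (cong₂ (λ p q → p ℤ.+ (q ℤ.+ 0ℤ)) (∑-cdWords-* (expandCD c) 0 K w) noWords)
    (trans (ℤ.+-identityʳ _)
      (act-cong (expandCD c) (ofDegree≗cdSum 1≤K) w)))
  go (suc (suc m)) m+2≤K = trans (ℤ.+-identityˡ _) (cong₂ ℤ._+_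
    (trans (∑-cdWords-* (expandCD c) (suc m) K w)
           (act-cong (expandCD c) (ofDegree≗cdSum m+2≤K) w))
    (trans (ℤ.+-identityʳ _)
    (trans (∑-cdWords-* (expandCD d) m K w)
           (act-cong (expandCD d) (ofDegree≗cdSum (ℕ.<-trans ℕ.≤-refl m+2≤K)) w))))

coeff-sumOfCDMonomials : ∀ m w → coeff (expand (sumOfCDMonomials m)) w ≡ cdSum m w
coeff-sumOfCDMonomials m w = begin
  coeff (expand (sumOfCDMonomials m)) w
    ≡⟨ coeff-sumₚ _ (sumOfCDMonomials m) w ⟩
  (∑ (sumOfCDMonomials m) λ (k , v) → coeff (scale k (expandWord v)) w)
    ≡⟨ ∑-concatMap monomial (cdMonomials m) _ ⟩
  (∑ (cdMonomials m) λ v → coeff (scale 1ℤ (expandWord v)) w ℤ.+ 0ℤ)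
    ≡⟨ ∑-cong (cdMonomials m) (λ v → trans (ℤ.+-identityʳ _)
                                           (coeff-scale-1 (expandWord v) w)) ⟩
  (∑ (cdMonomials m) λ v → coeff (expandWord v) w)
    ≡⟨ ∑-filter (λ v → degree v ℕ.≟ m) (cdWords (suc m)) _ ⟩
  ofDegree m (suc m) w
    ≡⟨ ofDegree≗cdSum {m} ℕ.≤-refl w ⟩
  cdSum m w ∎

-- Chains

-- The factor that a chain step of rank `j + 1` contributes to the weight, together with the `b`
-- after it.
stepPoly : ℕ → Poly AB
stepPoly j = a-b^ j *ₚ var b

module _ (Q : FiniteGradedPoset) where
  open FiniteGradedPoset Q

  ρ-mono-≤ : ∀ {x y} → x ≤ y → ρ x ℕ.≤ ρ y
  ρ-mono-≤ (inj₁ x<y)  = ℕ.<⇒≤ (ρ-mono x<y)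
  ρ-mono-≤ (inj₂ refl) = ℕ.≤-refl

  -- For `x < 1̂` and `K` large enough this is the ab-index of [x , 1̂]; the bound `K` on the number
  -- of inner elements is what the recursion descends on.
  chainSum : ℕ → Carrier → Series
  chainSum K x w = ∑ (concatMap (λ k → words k elements) (upTo K)) λ ys →
    when (linked? _<?_ (x ∷ ys ++ 1̂ ∷ [])) (coeff (wtFrom Q x ys) w)

  coeff-Ψ : ∀ w → coeff (Ψ Q) w ≡ chainSum (ρ 1̂) 0̂ w
  coeff-Ψ w = trans (coeff-sumₚ (wt Q) (chains Q) w)
                    (∑-filter (isChain? Q) (concatMap _ (upTo (ρ 1̂))) _)

  -- The first summand is the chain without inner elements. The sum also meets `y = 1̂`, where a
  -- fixed point `G` vanishes because nothing lies above `1̂`.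
  fromFirstStep : (Carrier → Series) → Carrier → Series
  fromFirstStep G x w =
    when (x <? 1̂) (coeff (a-b^ (ρ 1̂ ∸ ρ x ∸ 1)) w) ℤ.+
    ∑ elements λ y → when (x <? y) (act (stepPoly (ρ y ∸ ρ x ∸ 1)) (G y) w)

  chainSum-suc : ∀ K x w → chainSum (suc K) x w ≡ fromFirstStep (chainSum K) x w
  chainSum-suc K x w = trans (∑-words K elements λ ys →
      when (linked? _<?_ (x ∷ ys ++ 1̂ ∷ [])) (coeff (wtFrom Q x ys) w)) (cong₂ ℤ._+_
    (when-cong (linked? _<?_ (x ∷ 1̂ ∷ [])) (x <? 1̂)
               (λ { (x<1̂ ∷ _) → x<1̂ }) (λ x<1̂ → x<1̂ ∷ [-]) (λ _ → refl))
    (∑-cong elements step))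
    where
    step : ∀ y →
      ∑ (concatMap (λ k → words k elements) (upTo K)) (λ ys →
        when (linked? _<?_ (x ∷ y ∷ ys ++ 1̂ ∷ [])) (coeff (wtFrom Q x (y ∷ ys)) w)) ≡
      when (x <? y) (act (stepPoly (ρ y ∸ ρ x ∸ 1)) (chainSum K y) w)
    step y = begin
      ∑ ws (λ ys → when (linked? _<?_ (x ∷ y ∷ ys ++ 1̂ ∷ [])) (coeff (p *ₚ wtFrom Q y ys) w))
        ≡⟨ ∑-cong ws (λ ys → when-× (linked? _<?_ (x ∷ y ∷ ys ++ 1̂ ∷ []))
             (x <? y) (linked? _<?_ (y ∷ ys ++ 1̂ ∷ []))
             (λ { (x<y ∷ l) → x<y , l }) (λ (x<y , l) → x<y ∷ l)
             (λ _ → coeff-*ₚ p (wtFrom Q y ys) w)) ⟩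
      ∑ ws (λ ys → when (x <? y) (when (linked? _<?_ (y ∷ ys ++ 1̂ ∷ []))
                                       (act p (coeff (wtFrom Q y ys)) w)))
        ≡⟨ ∑-when (x <? y) ws _ ⟩
      when (x <? y) (∑ ws (λ ys → when (linked? _<?_ (y ∷ ys ++ 1̂ ∷ []))
                                       (act p (coeff (wtFrom Q y ys)) w)))
        ≡⟨ cong (when (x <? y)) (∑-cong ws λ ys →
             act-when p (linked? _<?_ (y ∷ ys ++ 1̂ ∷ [])) (coeff (wtFrom Q y ys)) w) ⟨
      when (x <? y) (∑ ws (λ ys → act p (λ w → when (linked? _<?_ (y ∷ ys ++ 1̂ ∷ []))
                                                   (coeff (wtFrom Q y ys) w)) w))
        ≡⟨ cong (when (x <? y)) (act-∑ p ws _ w) ⟨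
      when (x <? y) (act p (chainSum K y) w) ∎
      where
      ws = concatMap (λ k → words k elements) (upTo K)
      p  = stepPoly (ρ y ∸ ρ x ∸ 1)

  module _ {G : Carrier → Series} (G-rec : ∀ x w → G x w ≡ fromFirstStep G x w) where

    -- The recursion has only one solution: a step upwards raises `ρ` by at least 1, which pays for
    -- the loss of 1 in `K`. At `K = 0` the rank of `x` is maximal and both sides are empty sums.
    chainSum≗ : ∀ K x → ρ 1̂ ℕ.≤ K ℕ.+ ρ x → ∀ w → chainSum K x w ≡ G x w
    chainSum≗ zero x 1̂≤x w = sym (trans (G-rec x w) (cong₂ ℤ._+_
      (when-false (x <? 1̂) (nothingAbove 1̂))
      (∑-zero elements λ y → when-false (x <? y) (nothingAbove y))))
      where
      nothingAbove : ∀ y → ¬ x < y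
      nothingAbove y x<y =
        ℕ.<-irrefl refl (ℕ.<-≤-trans (ρ-mono x<y) (ℕ.≤-trans (ρ-mono-≤ (maximum y)) 1̂≤x))
    chainSum≗ (suc K) x 1̂≤K+x w = begin
      chainSum (suc K) x w
        ≡⟨ chainSum-suc K x w ⟩
      fromFirstStep (chainSum K) x w
        ≡⟨ cong (ℤ._+_ (when (x <? 1̂) (coeff (a-b^ (ρ 1̂ ∸ ρ x ∸ 1)) w))) (∑-cong elements λ y →
             when-cong (x <? y) (x <? y) (λ p → p) (λ p → p) λ x<y →
               act-cong (stepPoly (ρ y ∸ ρ x ∸ 1)) (chainSum≗ K y (1̂≤K+ x<y)) w) ⟩
      fromFirstStep G x w
        ≡⟨ G-rec x w ⟨
      G x w ∎
      where
      1̂≤K+ : ∀ {y} → x < y → ρ 1̂ ℕ.≤ K ℕ.+ ρ y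
      1̂≤K+ {y} x<y = ℕ.≤-trans 1̂≤K+x (ℕ.≤-trans
        (ℕ.≤-reflexive (sym (ℕ.+-suc K (ρ x)))) (ℕ.+-monoʳ-≤ K (ρ-mono x<y)))

    coeff-Ψ≗ : ∀ w → coeff (Ψ Q) w ≡ G 0̂ w
    coeff-Ψ≗ w = trans (coeff-Ψ w) (chainSum≗ (ρ 1̂) 0̂ (ℕ.m≤m+n (ρ 1̂) (ρ 0̂)) w)

-- Intervals of level posets

module _ {n : ℕ} (A : Matrix n) where
  private module L = LevelPoset A

  -- At `k = 0` the power is the identity matrix, so this single predicate describes the reflexive
  -- order between levels at distance `k`.
  Reach : ℕ → Fin n → Fin n → Set
  Reach k u v = 0 ℕ.< (A ^ᴹ k) u v

  reach? : ∀ k u v → Dec (Reach k u v)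
  reach? k u v = 0 ℕ.<? (A ^ᴹ k) u v

  <⇒reach : ∀ {u v i} k → (u , i) L.< (v , i ℤ.+ + k) → Reach k u v
  <⇒reach {i = i} k u<v with L.<⁻ u<v
  ... | l , eq , p = subst (λ k → Reach k _ _) (sym (L.shift-injective i eq)) p

  ≤⇒reach : ∀ {u v i} k → (u , i) L.≤ (v , i ℤ.+ + k) → Reach k u v
  ≤⇒reach k (inj₁ u<v) = <⇒reach k u<v
  ≤⇒reach {u} {v} {i} k (inj₂ eq) =
    subst₂ (λ k v → Reach k u v)
      (L.shift-injective i (trans (ℤ.+-identityʳ i) (cong proj₂ eq)))
      (cong proj₁ eq) (identity-pos A u)

  reach⇒≤ : ∀ {u v i} k → Reach k u v → (u , i) L.≤ (v , i ℤ.+ + k)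
  reach⇒≤ {u} {v} {i} zero p with u Fin.≟ v
  ... | yes refl = inj₂ (cong (u ,_) (sym (ℤ.+-identityʳ i)))
  reach⇒≤ (suc k) p = inj₁ (L.<⁺ k p)

  module _ (i : ℤ) {u v : Fin n} (k l : ℕ) where

    private
      shifted : i ℤ.+ + k ℤ.+ + l ≡ i ℤ.+ + (k ℕ.+ l)
      shifted = L.+-shift i k l

    ≤⇒reach-shifted : (u , i ℤ.+ + k) L.≤ (v , i ℤ.+ + (k ℕ.+ l)) → Reach l u v
    ≤⇒reach-shifted = ≤⇒reach l ∘ subst (λ j → _ L.≤ (v , j)) (sym shifted)

    reach⇒≤-shifted : Reach l u v → (u , i ℤ.+ + k) L.≤ (v , i ℤ.+ + (k ℕ.+ l))
    reach⇒≤-shifted = subst (λ j → _ L.≤ (v , j)) shifted ∘ reach⇒≤ l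

    <⇒reach-shifted : (u , i ℤ.+ + k) L.< (v , i ℤ.+ + (k ℕ.+ l)) → Reach l u v
    <⇒reach-shifted = ≤⇒reach-shifted ∘ inj₁

  reach⇒<-shifted : ∀ i {u v} k l → Reach (suc l) u v →
                    (u , i ℤ.+ + k) L.< (v , i ℤ.+ + (k ℕ.+ suc l))
  reach⇒<-shifted i k l p = subst (λ j → _ L.< (_ , j)) (L.+-shift i k (suc l)) (L.<⁺ l p)

  ∑-restrict : ∀ x y zs (f : L.Element → ℤ) →
    ∑ (L.restrict x y zs) (f ∘ value) ≡ ∑ zs λ z → when (L.between? x y z) (f z)
  ∑-restrict x y []       f = refl
  ∑-restrict x y (z ∷ zs) f with L.between? x y z
  ... | yes p = cong₂ ℤ._+_ (sym (when-true (L.between? x y z) p)) (∑-restrict x y zs f)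
  ... | no ¬p = trans (sym (ℤ.+-identityˡ _))
    (cong₂ ℤ._+_ (sym (when-false (L.between? x y z) ¬p)) (∑-restrict x y zs f))

  -- The candidates form the product of the vertices with the levels from `x` to `y`, so a sum over
  -- an interval becomes a guarded double sum.
  ∑-interval : ∀ x y (f : L.Element → ℤ) →
    let at = λ u k → (u , proj₂ x ℤ.+ + k) in
    ∑ (L.restrict x y (L.candidates x y)) (f ∘ value) ≡
    ∑ (allFin n) λ u → ∑ (upTo (suc ℤ.∣ proj₂ y ℤ.- proj₂ x ∣)) λ k →
      when (L.between? x y (at u k)) (f (at u k))
  ∑-interval x y f = trans (∑-restrict x y (L.candidates x y) f) (trans
    (∑-cartesianProductWith _,_ (allFin n) levels _)
    (∑-cong (allFin n) λ u →
      ∑-map (λ k → proj₂ x ℤ.+ + k) (upTo (suc ℤ.∣ proj₂ y ℤ.- proj₂ x ∣))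
            (λ j → when (L.between? x y (u , j)) (f (u , j)))))
    where
    levels = List.map (λ k → proj₂ x ℤ.+ + k) (upTo (suc ℤ.∣ proj₂ y ℤ.- proj₂ x ∣))

  -- Eulerian sums of intervals

  level<⇒≰ : ∀ i {u v} {k l} → l ℕ.< k → ¬ (u , i ℤ.+ + k) L.≤ (v , i ℤ.+ + l)
  level<⇒≰ i {k = k} {l} l<k u≤v = ℤ.<⇒≱ (ℤ.+-monoʳ-< i (ℤ.+<+ l<k)) (L.≤⇒level≤ u≤v)

  -- When `v` is reachable, this is the Eulerian sum of [(u , 0) , (v , k)]: the element (w , j)
  -- lies there if `w` is reached from `u` in `j` steps and `v` from `w` in the remaining ones.
  alternatingSum : ℕ → Fin n → Fin n → ℤ
  alternatingSum k u v = ∑ (allFin n) λ w → ∑ (upTo (suc k)) λ j →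
    when (reach? j u w) (when (reach? (k ∸ j) w v) (-1ℤ ℤ.^ j))

  module _ (alternatingSum≡0 : ∀ k u v → Reach (suc k) u v →
                               alternatingSum (suc k) u v ≡ 0ℤ) where

    -- The levels fall into `p` below the interval, `k + 2` inside it and `r` above it. The outer
    -- ones contribute nothing, and inside the sign of the offset `p` factors out of
    -- `alternatingSum`.
    ∑-between : ∀ i p k r {u v} → (u , i ℤ.+ + p) L.≤ (v , i ℤ.+ + (p ℕ.+ suc k)) →
      (∑ (allFin n) λ w → ∑ (upTo (p ℕ.+ (suc (suc k) ℕ.+ r))) λ l →
        when (L.between? (u , i ℤ.+ + p) (v , i ℤ.+ + (p ℕ.+ suc k)) (w , i ℤ.+ + l))
             (-1ℤ ℤ.^ l)) ≡ 0ℤ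
    ∑-between i p k r {u} {v} u≤v = begin
      (∑ (allFin n) λ w → ∑ (upTo (p ℕ.+ (suc (suc k) ℕ.+ r))) (term w))
        ≡⟨ ∑-cong (allFin n) (λ w → window w) ⟩
      (∑ (allFin n) λ w → -1ℤ ℤ.^ p ℤ.* ∑ (upTo (suc (suc k))) (walk w))
        ≡⟨ ∑-* (allFin n) (-1ℤ ℤ.^ p) _ ⟩
      -1ℤ ℤ.^ p ℤ.* alternatingSum (suc k) u v
        ≡⟨ cong (ℤ._*_ (-1ℤ ℤ.^ p))
             (alternatingSum≡0 k u v (≤⇒reach-shifted i p (suc k) u≤v)) ⟩
      -1ℤ ℤ.^ p ℤ.* 0ℤ
        ≡⟨ ℤ.*-zeroʳ (-1ℤ ℤ.^ p) ⟩
      0ℤ ∎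
      where
      x = (u , i ℤ.+ + p)
      y = (v , i ℤ.+ + (p ℕ.+ suc k))

      term : Fin n → ℕ → ℤ
      term w l = when (L.between? x y (w , i ℤ.+ + l)) (-1ℤ ℤ.^ l)

      walk : Fin n → ℕ → ℤ
      walk w j = when (reach? j u w) (when (reach? (suc k ∸ j) w v) (-1ℤ ℤ.^ j))

      below : ∀ w {l} → l ℕ.< p → term w l ≡ 0ℤ
      below w {l} l<p = when-false (L.between? x y (w , i ℤ.+ + l))
        (level<⇒≰ i l<p ∘ proj₁)

      above : ∀ w l → term w (p ℕ.+ (suc (suc k) ℕ.+ l)) ≡ 0ℤ
      above w l = when-false (L.between? x y (w , i ℤ.+ + (p ℕ.+ (suc (suc k) ℕ.+ l))))
        (level<⇒≰ i (ℕ.+-monoʳ-< p (ℕ.s≤s (ℕ.m≤m+n (suc k) l))) ∘ proj₂)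

      inside : ∀ w {j} → j ℕ.< suc (suc k) →
               term w (p ℕ.+ j) ≡ -1ℤ ℤ.^ p ℤ.* walk w j
      inside w {j} (ℕ.s≤s j≤k) = trans
        (when-× (L.between? x y (w , i ℤ.+ + (p ℕ.+ j)))
                (reach? j u w) (reach? (suc k ∸ j) w v)
          (λ (x≤z , z≤y) → ≤⇒reach-shifted i p j x≤z
                         , ≤⇒reach-shifted i (p ℕ.+ j) (suc k ∸ j)
                             (subst (λ q → at w j L.≤ (v , i ℤ.+ + q)) split z≤y))
          (λ (x→z , z→y) → reach⇒≤-shifted i p j x→z
                         , subst (λ q → at w j L.≤ (v , i ℤ.+ + q)) (sym split)
                             (reach⇒≤-shifted i (p ℕ.+ j) (suc k ∸ j) z→y))
          (λ _ → ℤ.^-distribˡ-+-* -1ℤ p j))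
        (trans (cong (when (reach? j u w)) (when-* (reach? (suc k ∸ j) w v) (-1ℤ ℤ.^ p)))
               (when-* (reach? j u w) (-1ℤ ℤ.^ p)))
        where
        at : Fin n → ℕ → L.Element
        at w j = (w , i ℤ.+ + (p ℕ.+ j))

        split : p ℕ.+ suc k ≡ p ℕ.+ j ℕ.+ (suc k ∸ j)
        split = trans (cong (p ℕ.+_) (sym (ℕ.m+[n∸m]≡n j≤k))) (sym (ℕ.+-assoc p j _))

      window : ∀ w → ∑ (upTo (p ℕ.+ (suc (suc k) ℕ.+ r))) (term w) ≡
                     -1ℤ ℤ.^ p ℤ.* ∑ (upTo (suc (suc k))) (walk w)
      window w = begin
        ∑ (upTo (p ℕ.+ (suc (suc k) ℕ.+ r))) (term w)
          ≡⟨ ∑-upTo-+ p (suc (suc k) ℕ.+ r) (term w) ⟩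
        ∑ (upTo p) (term w) ℤ.+ ∑ (upTo (suc (suc k) ℕ.+ r)) (term w ∘ (p ℕ.+_))
          ≡⟨ cong₂ ℤ._+_
               (trans (∑-upTo-cong p (below w)) (∑-zero (upTo p) λ _ → refl))
               (∑-upTo-+ (suc (suc k)) r (term w ∘ (p ℕ.+_))) ⟩
        0ℤ ℤ.+ (∑ (upTo (suc (suc k))) (term w ∘ (p ℕ.+_)) ℤ.+
                ∑ (upTo r) (λ l → term w (p ℕ.+ (suc (suc k) ℕ.+ l))))
          ≡⟨ ℤ.+-identityˡ _ ⟩
        ∑ (upTo (suc (suc k))) (term w ∘ (p ℕ.+_)) ℤ.+
        ∑ (upTo r) (λ l → term w (p ℕ.+ (suc (suc k) ℕ.+ l)))
          ≡⟨ cong₂ ℤ._+_ (∑-upTo-cong (suc (suc k)) (inside w))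
                         (∑-zero (upTo r) (above w)) ⟩
        ∑ (upTo (suc (suc k))) (λ j → -1ℤ ℤ.^ p ℤ.* walk w j) ℤ.+ 0ℤ
          ≡⟨ ℤ.+-identityʳ _ ⟩
        ∑ (upTo (suc (suc k))) (λ j → -1ℤ ℤ.^ p ℤ.* walk w j)
          ≡⟨ ∑-* (upTo (suc (suc k))) (-1ℤ ℤ.^ p) (walk w) ⟩
        -1ℤ ℤ.^ p ℤ.* ∑ (upTo (suc (suc k))) (walk w) ∎

    -- A subinterval [s , t] of [x , y] is itself an interval of the level poset, with ranks counted
    -- from the level of `x`; its offset there is `ρ s`.
    levelEulerian : L.LevelEulerian
    levelEulerian {x} {y} x≤y {s} {t} s≤t 1≤t-s = begin
      sumℤ (List.map sign (filter (λ z → (s ≤? z) ×-dec (z ≤? t)) elements))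
        ≡⟨ ∑-filter (λ z → (s ≤? z) ×-dec (z ≤? t)) elements sign ⟩
      (∑ elements λ z → when ((s ≤? z) ×-dec (z ≤? t)) (sign z))
        ≡⟨ ∑-cong elements (λ z →
             when-cong ((s ≤? z) ×-dec (z ≤? t)) (L.between? (value s) (value t) (value z))
               (λ (p , q) → ≤⇒value≤ p , ≤⇒value≤ q)
               (λ (p , q) → value≤⇒≤ p , value≤⇒≤ q) (λ _ → refl)) ⟩
      (∑ elements λ z → f (value z))
        ≡⟨ ∑-interval x y f ⟩
      (∑ (allFin n) λ w → ∑ (upTo (suc (ρ 1̂))) λ l →
        when (L.between? x y (w , proj₂ x ℤ.+ + l)) (f (w , proj₂ x ℤ.+ + l)))
        ≡⟨ ∑-cong (allFin n) (λ w → ∑-cong (upTo (suc (ρ 1̂))) λ l → simplify w l) ⟩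
      (∑ (allFin n) λ w → ∑ (upTo (suc (ρ 1̂))) λ l →
        when (L.between? (value s) (value t) (w , proj₂ x ℤ.+ + l)) (-1ℤ ℤ.^ l))
        ≡⟨ vanish (ρ s) (ρ t ∸ ρ s ∸ 1) (ρ 1̂ ∸ ρ t) (level s)
             (trans (level t) (cong (λ k → proj₂ x ℤ.+ + k) ρt≡))
             (trans (cong suc (sym (ℕ.m+[n∸m]≡n (ρ-mono-≤ Q (maximum t))))) (trans
                (cong (λ k → suc (k ℕ.+ (ρ 1̂ ∸ ρ t))) ρt≡) (arrange (ρ s) _ _)))
             (≤⇒value≤ s≤t) ⟩
      0ℤ ∎
      where
      Q = L.interval x y x≤y
      open FiniteGradedPoset Q

      sign : Carrier → ℤ
      sign z = -1ℤ ℤ.^ ρ z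

      f : L.Element → ℤ
      f z = when (L.between? (value s) (value t) z) (-1ℤ ℤ.^ ℤ.∣ proj₂ z ℤ.- proj₂ x ∣)

      ≤⇒value≤ : ∀ {z z′} → z ≤ z′ → value z L.≤ value z′
      ≤⇒value≤ (inj₁ p)    = inj₁ p
      ≤⇒value≤ (inj₂ refl) = inj₂ refl

      value≤⇒≤ : ∀ {z z′} → value z L.≤ value z′ → z ≤ z′
      value≤⇒≤ (inj₁ p) = inj₁ p
      value≤⇒≤ (inj₂ p) = inj₂ (Refinement.value-injective p)

      level : ∀ z → proj₂ (value z) ≡ proj₂ x ℤ.+ + ρ z
      level z = L.≤-shift (L.≤⇒level≤ (≤⇒value≤ (minimum z)))

      ρt≡ : ρ t ≡ ρ s ℕ.+ suc (ρ t ∸ ρ s ∸ 1)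
      ρt≡ = begin
        ρ t                              ≡⟨ ℕ.m+[n∸m]≡n (ρ-mono-≤ Q s≤t) ⟨
        ρ s ℕ.+ (ρ t ∸ ρ s)              ≡⟨ cong (ρ s ℕ.+_) (ℕ.m+[n∸m]≡n 1≤t-s) ⟨
        ρ s ℕ.+ suc (ρ t ∸ ρ s ∸ 1)      ∎

      arrange : ∀ p k r → suc (p ℕ.+ suc k ℕ.+ r) ≡ p ℕ.+ (suc (suc k) ℕ.+ r)
      arrange p k r = trans (cong suc (ℕ.+-assoc p (suc k) r)) (sym (ℕ.+-suc p _))

      simplify : ∀ w l →
        when (L.between? x y (w , proj₂ x ℤ.+ + l)) (f (w , proj₂ x ℤ.+ + l)) ≡
        when (L.between? (value s) (value t) (w , proj₂ x ℤ.+ + l)) (-1ℤ ℤ.^ l)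
      -- Lying between `s` and `t` implies lying between `x` and `y`, so the outer guard is
      -- absorbed.
      simplify w l = sym (when-× (L.between? (value s) (value t) z) (L.between? x y z)
        (L.between? (value s) (value t) z)
        (λ (s≤z , z≤t) → ( L.≤-trans (≤⇒value≤ (minimum s)) s≤z
                         , L.≤-trans z≤t (≤⇒value≤ (maximum t))) , s≤z , z≤t)
        proj₂
        (λ _ → cong (-1ℤ ℤ.^_) (sym (L.shift-∣-∣ (proj₂ x) l))))
        where z = (w , proj₂ x ℤ.+ + l)

      -- Levels and their number enter through equations, so that matching on `refl` brings the sum
      -- into the shape of `∑-between`.
      vanish : ∀ {N} {s t : L.Element} p k r →
        proj₂ s ≡ proj₂ x ℤ.+ + p → proj₂ t ≡ proj₂ x ℤ.+ + (p ℕ.+ suc k) →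
        N ≡ p ℕ.+ (suc (suc k) ℕ.+ r) → s L.≤ t →
        (∑ (allFin n) λ w → ∑ (upTo N) λ l →
          when (L.between? s t (w , proj₂ x ℤ.+ + l)) (-1ℤ ℤ.^ l)) ≡ 0ℤ
      vanish p k r refl refl refl s≤t = ∑-between (proj₂ x) p k r s≤t

  -- The ab-index recursion on a level poset

  level≤⇒≮ : ∀ i {u v} {k l} → l ℕ.≤ k → ¬ (u , i ℤ.+ + k) L.< (v , i ℤ.+ + l)
  level≤⇒≮ i l≤k (i+k<i+l , _) = ℤ.<⇒≱ i+k<i+l (ℤ.+-monoʳ-≤ i (ℤ.+≤+ l≤k))

  module _ {v₀ : Fin n} (G : Fin n → ℕ → Series)
    (G-zero : ∀ u w → G u 0 w ≡ 0ℤ)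
    (G-unreachable : ∀ u k → ¬ Reach k u v₀ → ∀ w → G u k w ≡ 0ℤ)
    (G-suc : ∀ u k w → G u (suc k) w ≡
      when (reach? (suc k) u v₀) (coeff (a-b^ k) w) ℤ.+
      ∑ (allFin n) λ v → ∑ (upTo (suc k)) λ j →
        when (reach? (suc j) u v) (act (stepPoly j) (G v (k ∸ j)) w))
    where

    -- `G` is indexed by the distance left to the top, so its value at `s` is taken at
    -- `suc m ∸ ρ s`. The recursion `G-suc` runs over all vertices reached from `u`, while the
    -- interval keeps only those below its top; `G-unreachable` closes the gap.
    coeff-Ψ-interval : ∀ u₀ i m (le : (u₀ , i) L.≤ (v₀ , i ℤ.+ + suc m)) w →
      coeff (Ψ (L.interval (u₀ , i) (v₀ , i ℤ.+ + suc m) le)) w ≡ G u₀ (suc m) w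
    coeff-Ψ-interval u₀ i m le w = trans
      (coeff-Ψ≗ Q {λ s → G (proj₁ (value s)) (suc m ∸ ρ s)} recursion w)
      (cong (λ k → G u₀ (suc m ∸ k) w) ρ-0̂)
      where
      x y : L.Element
      x = (u₀ , i)
      y = (v₀ , i ℤ.+ + suc m)
      Q = L.interval x y le
      open FiniteGradedPoset Q

      module Step (w : List AB) (u : Fin n) (k : ℕ) (x≤s : x L.≤ (u , i ℤ.+ + k)) where
        s : L.Element
        s = (u , i ℤ.+ + k)

        f : Fin n → ℕ → ℤ
        f v l = when (s L.<? (v , i ℤ.+ + l))
                     (act (stepPoly (l ∸ k ∸ 1)) (G v (suc m ∸ l)) w)

        term : Fin n → ℕ → ℤ
        term v l = when (L.between? x y (v , i ℤ.+ + l)) (f v l)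

        window : ∀ r v → ∑ (upTo (suc k ℕ.+ r)) (term v) ≡
                         ∑ (upTo r) (λ j → term v (suc k ℕ.+ j))
        window r v = trans (∑-upTo-+ (suc k) r (term v)) (trans
          (cong (ℤ._+ ∑ (upTo r) (λ j → term v (suc k ℕ.+ j)))
                (trans (∑-upTo-cong (suc k) below)
                                (∑-zero (upTo (suc k)) λ _ → refl)))
          (ℤ.+-identityˡ _))
          where
          below : ∀ {l} → l ℕ.< suc k → term v l ≡ 0ℤ
          below {l} l≤k = trans
            (cong (when (L.between? x y (v , i ℤ.+ + l)))
                  (when-false (s L.<? (v , i ℤ.+ + l)) (level≤⇒≮ i (ℕ.s≤s⁻¹ l≤k))))
            (when-zero (L.between? x y (v , i ℤ.+ + l)))

        inside : ∀ r → suc m ≡ k ℕ.+ suc r → ∀ v {j} → j ℕ.< suc r →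
          when (reach? (suc j) u v) (act (stepPoly j) (G v (r ∸ j)) w) ≡
          term v (suc k ℕ.+ j)
        inside r eq v {j} (ℕ.s≤s j≤r) = go (reach? (suc j) u v) (z L.≤? y)
          where
          z : L.Element
          z = (v , i ℤ.+ + (suc k ℕ.+ j))

          s<z : Reach (suc j) u v → s L.< z
          s<z p = subst (λ l → s L.< (v , i ℤ.+ + l)) (ℕ.+-suc k j)
                        (reach⇒<-shifted i k j p)

          z<s : s L.< z → Reach (suc j) u v
          z<s q = <⇒reach-shifted i k (suc j)
            (subst (λ l → s L.< (v , i ℤ.+ + l)) (sym (ℕ.+-suc k j)) q)

          m+1≡ : suc m ≡ suc k ℕ.+ r
          m+1≡ = trans eq (ℕ.+-suc k r)

          m+1≡′ : suc k ℕ.+ j ℕ.+ (r ∸ j) ≡ suc m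
          m+1≡′ = trans (ℕ.+-assoc (suc k) j _)
                        (trans (cong (suc k ℕ.+_) (ℕ.m+[n∸m]≡n j≤r)) (sym m+1≡))

          j≡ : j ≡ suc k ℕ.+ j ∸ k ∸ 1
          j≡ = sym (cong (_∸ 1) (trans (cong (_∸ k) (sym (ℕ.+-suc k j)))
                                       (ℕ.m+n∸m≡n k (suc j))))

          r-j≡ : r ∸ j ≡ suc m ∸ (suc k ℕ.+ j)
          r-j≡ = sym (trans (cong (_∸ (suc k ℕ.+ j)) m+1≡)
                            (ℕ.[m+n]∸[m+o]≡n∸o (suc k) r j))

          go : Dec (Reach (suc j) u v) → Dec (z L.≤ y) →
               when (reach? (suc j) u v) (act (stepPoly j) (G v (r ∸ j)) w) ≡
               term v (suc k ℕ.+ j)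
          go (no ¬p) _ = trans (when-false (reach? (suc j) u v) ¬p) (sym (trans
            (cong (when (L.between? x y z)) (when-false (s L.<? z) (¬p ∘ z<s)))
            (when-zero (L.between? x y z))))
          -- Here `z` lies above `s` but outside the interval: the right side has no such term, and
          -- on the left `G` vanishes.
          go (yes p) (no z≰y) = trans (when-true (reach? (suc j) u v) p) (trans
            (act-zero (stepPoly j)
              (G-unreachable v (r ∸ j) λ q → z≰y
                (subst (λ l → z L.≤ (v₀ , i ℤ.+ + l)) m+1≡′
                       (reach⇒≤-shifted i (suc k ℕ.+ j) (r ∸ j) q))) w)
            (sym (when-false (L.between? x y z) (z≰y ∘ proj₂))))
          go (yes p) (yes z≤y) = trans (when-true (reach? (suc j) u v) p) (trans
            (cong₂ (λ d e → act (stepPoly d) (G v e) w) j≡ r-j≡)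
            (sym (trans
              (when-true (L.between? x y z) (L.≤-trans x≤s (inj₁ (s<z p)) , z≤y))
              (when-true (s L.<? z) (s<z p)))))

        step : ∀ r → suc m ≡ k ℕ.+ r →
          G u r w ≡ when (s L.<? y) (coeff (a-b^ (suc m ∸ k ∸ 1)) w) ℤ.+
                    ∑ (allFin n) λ v → ∑ (upTo (suc k ℕ.+ r)) (term v)
        step zero eq = trans (G-zero u w) (sym (cong₂ ℤ._+_
          (when-false (s L.<? y) (level≤⇒≮ i
            (ℕ.≤-reflexive (trans eq (ℕ.+-identityʳ k)))))
          (∑-zero (allFin n) (window 0))))
        step (suc r) eq = trans (G-suc u r w) (cong₂ ℤ._+_
          (when-cong (reach? (suc r) u v₀) (s L.<? y)
            (λ p → subst (λ l → s L.< (v₀ , i ℤ.+ + l)) (sym eq) (reach⇒<-shifted i k r p))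
            (λ q → <⇒reach-shifted i k (suc r)
                     (subst (λ l → s L.< (v₀ , i ℤ.+ + l)) eq q))
            (λ _ → cong (λ d → coeff (a-b^ (d ∸ 1)) w)
                     (sym (trans (cong (_∸ k) eq) (ℕ.m+n∸m≡n k (suc r))))))
          (∑-cong (allFin n) λ v → trans (∑-upTo-cong (suc r) (inside r eq v))
                                         (sym (window (suc r) v))))

      ρ-1̂ : ρ 1̂ ≡ suc m
      ρ-1̂ = L.shift-∣-∣ i (suc m)

      recursion : ∀ s w → G (proj₁ (value s)) (suc m ∸ ρ s) w ≡
        fromFirstStep Q (λ s → G (proj₁ (value s)) (suc m ∸ ρ s)) s w
      recursion s w = sym (begin
        fromFirstStep Q (λ s → G (proj₁ (value s)) (suc m ∸ ρ s)) s w
          ≡⟨ cong (ℤ._+_ (first (value s) (ρ 1̂))) (trans (∑-interval x y g)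
               (∑-cong (allFin n) λ v → ∑-cong (upTo (suc (ρ 1̂))) λ l →
                 cong (λ k → when (L.between? x y (v , i ℤ.+ + l))
                   (when (value s L.<? (v , i ℤ.+ + l))
                     (act (stepPoly (k ∸ ρ s ∸ 1)) (G v (suc m ∸ k)) w)))
                   (L.shift-∣-∣ i l))) ⟩
        first (value s) (ρ 1̂) ℤ.+ rest (value s) (ρ 1̂)
          ≡⟨ cong₂ (λ s k → first s k ℤ.+ rest s k) (cong (u ,_) level) ρ-1̂ ⟩
        first s′ (suc m) ℤ.+ rest s′ (suc m)
          ≡⟨ cong (λ k → first s′ (suc m) ℤ.+ rest s′ k) split ⟩
        first s′ (suc m) ℤ.+ rest s′ (ρ s ℕ.+ (suc m ∸ ρ s))
          ≡⟨ Step.step w u (ρ s) (subst (x L.≤_) (cong (u ,_) level) x≤s)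
               (suc m ∸ ρ s) split ⟨
        G u (suc m ∸ ρ s) w ∎)
        where
        u = proj₁ (value s)

        x≤s : x L.≤ value s
        x≤s with minimum s
        ... | inj₁ x<s  = inj₁ x<s
        ... | inj₂ refl = inj₂ refl

        level : proj₂ (value s) ≡ i ℤ.+ + ρ s
        level = L.≤-shift (L.≤⇒level≤ x≤s)

        s′ : L.Element
        s′ = (u , i ℤ.+ + ρ s)

        split : suc m ≡ ρ s ℕ.+ (suc m ∸ ρ s)
        split = sym (ℕ.m+[n∸m]≡n (subst (ρ s ℕ.≤_) ρ-1̂ (ρ-mono-≤ Q (maximum s))))

        g : L.Element → ℤ
        g z = when (value s L.<? z)
          (act (stepPoly (ℤ.∣ proj₂ z ℤ.- i ∣ ∸ ρ s ∸ 1))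
               (G (proj₁ z) (suc m ∸ ℤ.∣ proj₂ z ℤ.- i ∣)) w)

        -- The point and the top rank are arguments, so that they can be rewritten along `level`,
        -- `ρ-1̂` and `split`.
        first rest : L.Element → ℕ → ℤ
        first s′ k = when (s′ L.<? y) (coeff (a-b^ (k ∸ ρ s ∸ 1)) w)
        rest  s′ k = ∑ (allFin n) λ v → ∑ (upTo (suc k)) λ l →
          when (L.between? x y (v , i ℤ.+ + l)) (when (s′ L.<? (v , i ℤ.+ + l))
            (act (stepPoly (l ∸ ρ s ∸ 1)) (G v (suc m ∸ l)) w))

-- The matrix M

-- The cube is checked entrywise, and since every row of `M` has a positive entry, a further factor
-- `M` on the left keeps all entries positive.
reach-3+ : ∀ k u v → Reach M (3 ℕ.+ k) u v
reach-3+ zero    = from-yes (Fin.all? λ u → Fin.all? λ v → reach? M 3 u v)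
reach-3+ (suc k) u v = 
  ⊗-pos⁺ M (M ^ᴹ (3 ℕ.+ k)) {u} {successor u .proj₁} {v}
         (successor u .proj₂) (reach-3+ k (successor u .proj₁) v)
  where
  successor : ∀ u → ∃[ w ] 0 ℕ.< M u w
  successor zero                   = zero , ℕ.z<s
  successor (suc zero)             = zero , ℕ.z<s
  successor (suc (suc zero))       = suc zero , ℕ.z<s
  successor (suc (suc (suc zero))) = zero , ℕ.z<s

reach-2+-zero : ∀ k u → Reach M (2 ℕ.+ k) u zero
reach-2+-zero zero    = from-yes (Fin.all? λ u → reach? M 2 u zero)
reach-2+-zero (suc k) = λ u → reach-3+ k u zero

-- Alternating sums for M

2*∑-1^ : ∀ n → + 2 ℤ.* ∑ (upTo n) (-1ℤ ℤ.^_) ≡ 1ℤ ℤ.- -1ℤ ℤ.^ n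
2*∑-1^ zero    = refl
-- With the factor 2 the closed form holds for both parities of `n` at once.
2*∑-1^ (suc n) = begin
  + 2 ℤ.* ∑ (upTo (suc n)) (-1ℤ ℤ.^_)
    ≡⟨ cong (ℤ._*_ (+ 2)) (trans (∑-upTo-suc n (-1ℤ ℤ.^_))
         (cong (ℤ._+_ 1ℤ) (∑-* (upTo n) -1ℤ (-1ℤ ℤ.^_)))) ⟩
  + 2 ℤ.* (1ℤ ℤ.+ -1ℤ ℤ.* ∑ (upTo n) (-1ℤ ℤ.^_))
    ≡⟨ lhs (∑ (upTo n) (-1ℤ ℤ.^_)) ⟩
  + 2 ℤ.- + 2 ℤ.* ∑ (upTo n) (-1ℤ ℤ.^_)
    ≡⟨ cong (ℤ._-_ (+ 2)) (2*∑-1^ n) ⟩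
  + 2 ℤ.- (1ℤ ℤ.- -1ℤ ℤ.^ n)
    ≡⟨ rhs (-1ℤ ℤ.^ n) ⟩
  1ℤ ℤ.- -1ℤ ℤ.^ suc n ∎
  where
  lhs : ∀ s → + 2 ℤ.* (1ℤ ℤ.+ -1ℤ ℤ.* s) ≡ + 2 ℤ.- + 2 ℤ.* s
  lhs = solve-∀
  rhs : ∀ s → + 2 ℤ.- (1ℤ ℤ.- s) ≡ 1ℤ ℤ.- -1ℤ ℤ.* s
  rhs = solve-∀

-- The `7 + k` levels split as 3 + (k + 1) + 3. With σ = (-1)^k the three parts are 2, -2(1 + σ) and
-- 2σ.
alternatingSum-long : ∀ k u v → alternatingSum M (6 ℕ.+ k) u v ≡ 0ℤ
alternatingSum-long k u v = begin
  alternatingSum M (6 ℕ.+ k) u v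
    ≡⟨ ∑-swap (allFin 4) (upTo (7 ℕ.+ k)) walk ⟩
  ∑ (upTo (7 ℕ.+ k)) level
    ≡⟨ cong (λ l → ∑ (upTo (4 ℕ.+ l)) level) (ℕ.+-comm 3 k) ⟩
  ∑ (upTo (3 ℕ.+ (suc k ℕ.+ 3))) level
    ≡⟨ ∑-upTo-+ 3 (suc k ℕ.+ 3) level ⟩
  ∑ (upTo 3) level ℤ.+ ∑ (upTo (suc k ℕ.+ 3)) (level ∘ (3 ℕ.+_))
    ≡⟨ cong (ℤ._+_ (∑ (upTo 3) level)) (∑-upTo-+ (suc k) 3 (level ∘ (3 ℕ.+_))) ⟩
  ∑ (upTo 3) level ℤ.+ (∑ (upTo (suc k)) (level ∘ (3 ℕ.+_)) ℤ.+
                        ∑ (upTo 3) (λ j → level (3 ℕ.+ (suc k ℕ.+ j))))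
    ≡⟨ cong₂ ℤ._+_ bottomLevels (cong₂ ℤ._+_ middleLevels topLevels) ⟩
  + 2 ℤ.+ (ℤ.- + 2 ℤ.* (1ℤ ℤ.- -1ℤ ℤ.* σ) ℤ.+ σ ℤ.* + 2)
    ≡⟨ cancel σ ⟩
  0ℤ ∎
  where
  σ = -1ℤ ℤ.^ k

  cancel : ∀ s → + 2 ℤ.+ (ℤ.- + 2 ℤ.* (1ℤ ℤ.- -1ℤ ℤ.* s) ℤ.+ s ℤ.* + 2) ≡ 0ℤ
  cancel = solve-∀

  walk : Fin 4 → ℕ → ℤ
  walk w j = when (reach? M j u w) (when (reach? M (6 ℕ.+ k ∸ j) w v) (-1ℤ ℤ.^ j))

  level : ℕ → ℤ
  level j = ∑ (allFin 4) λ w → walk w j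

  -- The first and the last three levels, without the condition that has
  -- become vacuous there.
  bottomWalk topWalk : Fin 4 → ℕ → ℤ
  bottomWalk w j = when (reach? M j u w) (-1ℤ ℤ.^ j)
  topWalk    w j = when (reach? M (2 ∸ j) w v) (-1ℤ ℤ.^ j)

  bottomLevel : ∀ {j} → j ℕ.< 3 →
    level j ≡ ∑ (allFin 4) λ w → bottomWalk w j
  bottomLevel {j} (ℕ.s≤s j≤2) = ∑-cong (allFin 4) {λ w → walk w j} {λ w → bottomWalk w j} λ w →
    cong (when (reach? M j u w)) (when-true (reach? M (6 ℕ.+ k ∸ j) w v)
      (subst (λ l → Reach M l w v) (sym (ℕ.+-∸-assoc 3 (ℕ.≤-trans j≤2 (ℕ.m≤m+n 2 (suc k)))))
             (reach-3+ (3 ℕ.+ k ∸ j) w v)))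

  -- Each row of B₂ has one more positive entry than the same row of B₁: the sum is 1 - 3 + 4, or 1
  -- - 2 + 3 in row 3.
  bottomLevels : ∑ (upTo 3) level ≡ + 2
  bottomLevels = trans
    (∑-upTo-cong 3 {level} {λ j → ∑ (allFin 4) λ w → bottomWalk w j} bottomLevel) (from-yes
    (Fin.all? λ u → ∑ (upTo 3) (λ j → ∑ (allFin 4) λ w →
      when (reach? M j u w) (-1ℤ ℤ.^ j)) ℤ.≟ + 2) u)

  middleLevel : ∀ {j} → j ℕ.< suc k → level (3 ℕ.+ j) ≡ ℤ.- + 4 ℤ.* -1ℤ ℤ.^ j
  middleLevel {j} (ℕ.s≤s j≤k) = trans
    (∑-cong (allFin 4) {λ w → walk w (3 ℕ.+ j)} {λ _ → -1ℤ ℤ.^ (3 ℕ.+ j)} λ w → trans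
      (when-true (reach? M (3 ℕ.+ j) u w) (reach-3+ j u w))
      (when-true (reach? M (3 ℕ.+ k ∸ j) w v)
        (subst (λ l → Reach M l w v) (sym (ℕ.+-∸-assoc 3 j≤k)) (reach-3+ (k ∸ j) w v))))
    (fourfold (-1ℤ ℤ.^ j))
    where
    fourfold : ∀ s → let t = -1ℤ ℤ.* (-1ℤ ℤ.* (-1ℤ ℤ.* s)) in
               t ℤ.+ (t ℤ.+ (t ℤ.+ (t ℤ.+ 0ℤ))) ≡ ℤ.- + 4 ℤ.* s
    fourfold = solve-∀

  middleLevels : ∑ (upTo (suc k)) (level ∘ (3 ℕ.+_)) ≡
                 ℤ.- + 2 ℤ.* (1ℤ ℤ.- -1ℤ ℤ.* σ)
  middleLevels = begin
    ∑ (upTo (suc k)) (level ∘ (3 ℕ.+_))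
      ≡⟨ ∑-upTo-cong (suc k) middleLevel ⟩
    ∑ (upTo (suc k)) (λ j → ℤ.- + 4 ℤ.* -1ℤ ℤ.^ j)
      ≡⟨ ∑-* (upTo (suc k)) (ℤ.- + 4) (-1ℤ ℤ.^_) ⟩
    ℤ.- + 4 ℤ.* ∑ (upTo (suc k)) (-1ℤ ℤ.^_)
      ≡⟨ ℤ.*-assoc (ℤ.- + 2) (+ 2) (∑ (upTo (suc k)) (-1ℤ ℤ.^_)) ⟩
    ℤ.- + 2 ℤ.* (+ 2 ℤ.* ∑ (upTo (suc k)) (-1ℤ ℤ.^_))
      ≡⟨ cong (ℤ._*_ (ℤ.- + 2)) (2*∑-1^ (suc k)) ⟩
    ℤ.- + 2 ℤ.* (1ℤ ℤ.- -1ℤ ℤ.* σ) ∎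

  topLevel : ∀ j → level (3 ℕ.+ (suc k ℕ.+ j)) ≡
    σ ℤ.* ∑ (allFin 4) λ w → topWalk w j
  topLevel j = trans
    (∑-cong (allFin 4) {λ w → walk w (3 ℕ.+ (suc k ℕ.+ j))} {λ w → σ ℤ.* topWalk w j} λ w → begin
      when (reach? M (3 ℕ.+ (suc k ℕ.+ j)) u w)
        (when (reach? M (2 ℕ.+ k ∸ (k ℕ.+ j)) w v) (-1ℤ ℤ.^ (4 ℕ.+ (k ℕ.+ j))))
        ≡⟨ when-true (reach? M (3 ℕ.+ (suc k ℕ.+ j)) u w) (reach-3+ (suc k ℕ.+ j) u w) ⟩
      when (reach? M (2 ℕ.+ k ∸ (k ℕ.+ j)) w v) (-1ℤ ℤ.^ (4 ℕ.+ (k ℕ.+ j)))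
        ≡⟨ cong₂ (λ l s → when (reach? M l w v) s) remaining sign ⟩
      when (reach? M (2 ∸ j) w v) (σ ℤ.* -1ℤ ℤ.^ j)
        ≡⟨ when-* (reach? M (2 ∸ j) w v) σ ⟩
      σ ℤ.* when (reach? M (2 ∸ j) w v) (-1ℤ ℤ.^ j) ∎)
    (∑-* (allFin 4) σ λ w → topWalk w j)
    where
    remaining : 2 ℕ.+ k ∸ (k ℕ.+ j) ≡ 2 ∸ j
    remaining = trans (cong (_∸ (k ℕ.+ j)) (ℕ.+-comm 2 k)) (ℕ.[m+n]∸[m+o]≡n∸o k 2 j)

    period : ∀ s → -1ℤ ℤ.* (-1ℤ ℤ.* (-1ℤ ℤ.* (-1ℤ ℤ.* s))) ≡ s
    period = solve-∀

    sign : -1ℤ ℤ.^ (4 ℕ.+ (k ℕ.+ j)) ≡ σ ℤ.* -1ℤ ℤ.^ j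
    sign = trans (period (-1ℤ ℤ.^ (k ℕ.+ j))) (ℤ.^-distribˡ-+-* -1ℤ k j)

  topLevels : ∑ (upTo 3) (λ j → level (3 ℕ.+ (suc k ℕ.+ j))) ≡ σ ℤ.* + 2
  topLevels = trans
    (∑-cong (upTo 3) {λ j → level (3 ℕ.+ (suc k ℕ.+ j))}
            {λ j → σ ℤ.* ∑ (allFin 4) λ w → topWalk w j} topLevel)
    (trans (∑-* (upTo 3) σ λ j → ∑ (allFin 4) λ w → topWalk w j)
    (cong (ℤ._*_ σ) (from-yes
      (Fin.all? λ v → ∑ (upTo 3) (λ j → ∑ (allFin 4) λ w →
        when (reach? M (2 ∸ j) w v) (-1ℤ ℤ.^ j)) ℤ.≟ + 2) v)))

alternatingSum≡0 : ∀ k u v → Reach M (suc k) u v → alternatingSum M (suc k) u v ≡ 0ℤ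
alternatingSum≡0 (suc (suc (suc (suc (suc k))))) u v _ = alternatingSum-long k u v
alternatingSum≡0 0 = from-yes (Fin.all? λ u → Fin.all? λ v →
  reach? M 1 u v →-dec (alternatingSum M 1 u v ℤ.≟ 0ℤ))
alternatingSum≡0 1 = from-yes (Fin.all? λ u → Fin.all? λ v →
  reach? M 2 u v →-dec (alternatingSum M 2 u v ℤ.≟ 0ℤ))
alternatingSum≡0 2 = from-yes (Fin.all? λ u → Fin.all? λ v →
  reach? M 3 u v →-dec (alternatingSum M 3 u v ℤ.≟ 0ℤ))
alternatingSum≡0 3 = from-yes (Fin.all? λ u → Fin.all? λ v →
  reach? M 4 u v →-dec (alternatingSum M 4 u v ℤ.≟ 0ℤ))
alternatingSum≡0 4 = from-yes (Fin.all? λ u → Fin.all? λ v →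
  reach? M 5 u v →-dec (alternatingSum M 5 u v ℤ.≟ 0ℤ))

-- Solving the recursion for M

act-c : ∀ (X : Series) w → act (expandCD c) X w ≡ (a ◂ X) w ℤ.+ (b ◂ X) w
act-c X w = simplify ((a ◂ X) w) ((b ◂ X) w)
  where
  simplify : ∀ p q → 1ℤ ℤ.* p ℤ.+ (1ℤ ℤ.* q ℤ.+ 0ℤ) ≡ p ℤ.+ q
  simplify = solve-∀

act-d : ∀ (X : Series) w → act (expandCD d) X w ≡ (a ◂ b ◂ X) w ℤ.+ (b ◂ a ◂ X) w
act-d X w = simplify ((a ◂ b ◂ X) w) ((b ◂ a ◂ X) w)
  where
  simplify : ∀ p q → 1ℤ ℤ.* p ℤ.+ (1ℤ ℤ.* q ℤ.+ 0ℤ) ≡ p ℤ.+ q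
  simplify = solve-∀

act-a-b : ∀ (X : Series) w → act (var a -ₚ var b) X w ≡ (a ◂ X) w ℤ.- (b ◂ X) w
act-a-b X w = simplify ((a ◂ X) w) ((b ◂ X) w)
  where
  simplify : ∀ p q → 1ℤ ℤ.* p ℤ.+ (-1ℤ ℤ.* q ℤ.+ 0ℤ) ≡ p ℤ.- q
  simplify = solve-∀

act-stepPoly-zero : ∀ (X : Series) w → act (stepPoly 0) X w ≡ (b ◂ X) w
act-stepPoly-zero X w = trans (ℤ.+-identityʳ _) (ℤ.*-identityˡ _)

act-stepPoly-suc : ∀ j (X : Series) w →
  act (stepPoly (suc j)) X w ≡ act (var a -ₚ var b) (act (stepPoly j) X) w
act-stepPoly-suc j X w = begin
  act (a-b^ (suc j) *ₚ var b) X w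
    ≡⟨ act-*ₚ (a-b^ (suc j)) (var b) X w ⟩
  act (a-b^ (suc j)) (act (var b) X) w
    ≡⟨ act-*ₚ (var a -ₚ var b) (a-b^ j) (act (var b) X) w ⟩
  act (var a -ₚ var b) (act (a-b^ j) (act (var b) X)) w
    ≡⟨ act-cong (var a -ₚ var b) (act-*ₚ (a-b^ j) (var b) X) w ⟨
  act (var a -ₚ var b) (act (a-b^ j *ₚ var b) X) w ∎

act-stepPoly-one : ∀ (X : Series) w →
  act (stepPoly 1) X w ≡ (a ◂ b ◂ X) w ℤ.- (b ◂ b ◂ X) w
act-stepPoly-one X w = begin
  act (stepPoly 1) X w
    ≡⟨ act-stepPoly-suc 0 X w ⟩
  act (var a -ₚ var b) (act (stepPoly 0) X) w
    ≡⟨ act-cong (var a -ₚ var b) (act-stepPoly-zero X) w ⟩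
  act (var a -ₚ var b) (b ◂ X) w
    ≡⟨ act-a-b (b ◂ X) w ⟩
  (a ◂ b ◂ X) w ℤ.- (b ◂ b ◂ X) w ∎

act-+ : ∀ p (X Y : Series) w →
        act p (λ w → X w ℤ.+ Y w) w ≡ act p X w ℤ.+ act p Y w
act-+ p X Y w = begin
  act p (λ w → X w ℤ.+ Y w) w
    ≡⟨ act-cong p (λ w → cong (ℤ._+_ (X w)) (sym (ℤ.+-identityʳ (Y w)))) w ⟩
  act p (λ w → ∑ (X ∷ Y ∷ []) λ Z → Z w) w
    ≡⟨ act-∑ p (X ∷ Y ∷ []) (λ Z → Z) w ⟩
  act p X w ℤ.+ (act p Y w ℤ.+ 0ℤ)
    ≡⟨ cong (ℤ._+_ (act p X w)) (ℤ.+-identityʳ _) ⟩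
  act p X w ℤ.+ act p Y w ∎

b◂c : ∀ (X : Series) w →
      (b ◂ act (expandCD c) X) w ≡ (b ◂ a ◂ X) w ℤ.+ (b ◂ b ◂ X) w
b◂c X w = trans (◂-cong b (act-c X) w) (◂-+ b (a ◂ X) (b ◂ X) w)

-- This is d = (a - b)b + bc, obtained from ab + ba by subtracting and adding bb.
cd-split : ∀ (X : Series) w → act (expandCD d) X w ≡
           act (stepPoly 1) X w ℤ.+ (b ◂ act (expandCD c) X) w
cd-split X w = begin
  act (expandCD d) X w
    ≡⟨ act-d X w ⟩
  (a ◂ b ◂ X) w ℤ.+ (b ◂ a ◂ X) w
    ≡⟨ rearrange ((a ◂ b ◂ X) w) ((b ◂ a ◂ X) w) ((b ◂ b ◂ X) w) ⟩
  (a ◂ b ◂ X) w ℤ.- (b ◂ b ◂ X) w ℤ.+ ((b ◂ a ◂ X) w ℤ.+ (b ◂ b ◂ X) w)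
    ≡⟨ cong₂ ℤ._+_ (act-stepPoly-one X w) (b◂c X w) ⟨
  act (stepPoly 1) X w ℤ.+ (b ◂ act (expandCD c) X) w ∎
  where
  rearrange : ∀ p q r → p ℤ.+ q ≡ p ℤ.- r ℤ.+ (q ℤ.+ r)
  rearrange = solve-∀

-- The ab-series of the interval [(u , 0) , (1 , k)].
abSeries : Fin 4 → ℕ → Series
abSeries _                      zero          w = 0ℤ
abSeries zero                   (suc k)       w = cdSum k w
abSeries (suc zero)             (suc k)       w = cdSum k w
abSeries (suc (suc zero))       (suc zero)    w = 0ℤ
abSeries (suc (suc zero))       (suc (suc k)) w = act (expandCD c) (cdSum k) w
abSeries (suc (suc (suc zero))) (suc k)       w = cdSum k w

-- What the recursion would give if all powers of M were positive.
saturated : ℕ → Series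
saturated k w = coeff (a-b^ k) w ℤ.+
  ∑ (upTo (suc k)) λ j → ∑ (allFin 4) λ v → act (stepPoly j) (abSeries v (k ∸ j)) w

-- All terms except those with `j = 0` carry a factor t = a - b on the left, and taking it out
-- leaves the sum for `k`.
saturated-suc : ∀ k w → saturated (suc k) w ≡
  act (var a -ₚ var b) (saturated k) w ℤ.+
  ∑ (allFin 4) λ v → (b ◂ abSeries v (suc k)) w
saturated-suc k w = begin
  coeff (a-b^ (suc k)) w ℤ.+ ∑ (upTo (suc (suc k))) (steps (suc k) w)
    ≡⟨ cong₂ ℤ._+_ (coeff-*ₚ t (a-b^ k) w) (∑-upTo-suc (suc k) (steps (suc k) w)) ⟩
  act t (coeff (a-b^ k)) w ℤ.+
  (steps (suc k) w 0 ℤ.+ ∑ (upTo (suc k)) (steps (suc k) w ∘ suc))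
    ≡⟨ cong (ℤ._+_ (act t (coeff (a-b^ k)) w)) (cong₂ ℤ._+_
         (∑-cong (allFin 4) {λ v → act (stepPoly 0) (abSeries v (suc k)) w}
                            {λ v → (b ◂ abSeries v (suc k)) w}
                 λ v → act-stepPoly-zero (abSeries v (suc k)) w)
         (trans (∑-cong (upTo (suc k)) {steps (suc k) w ∘ suc}
                        {λ j → act t (λ w → steps k w j) w} later)
                (sym (act-∑ t (upTo (suc k)) (λ j w → steps k w j) w)))) ⟩
  act t (coeff (a-b^ k)) w ℤ.+
  (first ℤ.+ act t (λ w → ∑ (upTo (suc k)) (steps k w)) w)
    ≡⟨ rotate (act t (coeff (a-b^ k)) w) first _ ⟩
  act t (coeff (a-b^ k)) w ℤ.+ act t (λ w → ∑ (upTo (suc k)) (steps k w)) w ℤ.+ first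
    ≡⟨ cong (ℤ._+ first) (act-+ t (coeff (a-b^ k)) (λ w → ∑ (upTo (suc k)) (steps k w)) w) ⟨
  act t (saturated k) w ℤ.+ first ∎
  where
  t = var a -ₚ var b

  steps : ℕ → List AB → ℕ → ℤ
  steps k w j = ∑ (allFin 4) λ v → act (stepPoly j) (abSeries v (k ∸ j)) w

  first = ∑ (allFin 4) λ v → (b ◂ abSeries v (suc k)) w

  later : ∀ j → steps (suc k) w (suc j) ≡ act t (λ w → steps k w j) w
  later j = trans
    (∑-cong (allFin 4) {λ v → act (stepPoly (suc j)) (abSeries v (k ∸ j)) w}
                       {λ v → act t (act (stepPoly j) (abSeries v (k ∸ j))) w}
            λ v → act-stepPoly-suc j (abSeries v (k ∸ j)) w)
    (sym (act-∑ t (allFin 4) (λ v → act (stepPoly j) (abSeries v (k ∸ j))) w))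

  rotate : ∀ p q r → p ℤ.+ (q ℤ.+ r) ≡ p ℤ.+ r ℤ.+ q
  rotate = solve-∀

b◂zero : ∀ w → (b ◂ λ _ → 0ℤ) w ≡ 0ℤ
b◂zero []      = refl
b◂zero (a ∷ w) = refl
b◂zero (b ∷ w) = refl

saturated-zero : ∀ w → saturated 0 w ≡ cdSum 0 w
saturated-zero w = trans
  (cong (λ k → coeff 1ₚ w ℤ.+ (k ℤ.+ 0ℤ))
    (∑-zero (allFin 4) {λ v → act (stepPoly 0) (abSeries v 0) w}
            λ v → act-zero (stepPoly 0) (λ _ → refl) w))
  (ℤ.+-identityʳ (coeff 1ₚ w))

-- Induction by `saturated-suc`. Three vertices contribute bF_{k+1} and vertex 3 contributes bcF_k,
-- so the next value is t(F_{k+1} + bF_k) + 3bF_{k+1} + bcF_k. As t + 3b = c + b and tb + bc = d,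
-- this is F_{k+2} + bF_{k+1}.
saturated-closed : ∀ k w → saturated (suc k) w ≡ cdSum (suc k) w ℤ.+ (b ◂ cdSum k) w
saturated-closed zero w = begin
  saturated 1 w
    ≡⟨ saturated-suc 0 w ⟩
  act t (saturated 0) w ℤ.+ (β ℤ.+ (β ℤ.+ ((b ◂ abSeries third 1) w ℤ.+ (β ℤ.+ 0ℤ))))
    ≡⟨ cong₂ (λ p q → p ℤ.+ (β ℤ.+ (β ℤ.+ (q ℤ.+ (β ℤ.+ 0ℤ)))))
         (trans (act-cong t saturated-zero w) (act-a-b (cdSum 0) w)) (b◂zero w) ⟩
  α ℤ.- β ℤ.+ (β ℤ.+ (β ℤ.+ (0ℤ ℤ.+ (β ℤ.+ 0ℤ))))
    ≡⟨ collect α β ⟩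
  α ℤ.+ β ℤ.+ β
    ≡⟨ cong (ℤ._+ β) (act-c (cdSum 0) w) ⟨
  cdSum 1 w ℤ.+ β ∎
  where
  t = var a -ₚ var b
  third = suc (suc zero)
  α = (a ◂ cdSum 0) w
  β = (b ◂ cdSum 0) w
  collect : ∀ α β →
    α ℤ.- β ℤ.+ (β ℤ.+ (β ℤ.+ (0ℤ ℤ.+ (β ℤ.+ 0ℤ)))) ≡ α ℤ.+ β ℤ.+ β
  collect = solve-∀
saturated-closed (suc k) w = begin
  saturated (suc (suc k)) w
    ≡⟨ saturated-suc (suc k) w ⟩
  act t (saturated (suc k)) w ℤ.+ (β ℤ.+ (β ℤ.+ (γ ℤ.+ (β ℤ.+ 0ℤ))))
    ≡⟨ cong (ℤ._+ (β ℤ.+ (β ℤ.+ (γ ℤ.+ (β ℤ.+ 0ℤ))))) (begin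
         act t (saturated (suc k)) w
           ≡⟨ act-cong t (saturated-closed k) w ⟩
         act t (λ w → cdSum (suc k) w ℤ.+ (b ◂ cdSum k) w) w
           ≡⟨ act-+ t (cdSum (suc k)) (b ◂ cdSum k) w ⟩
         act t (cdSum (suc k)) w ℤ.+ act t (b ◂ cdSum k) w
           ≡⟨ cong₂ ℤ._+_ (act-a-b (cdSum (suc k)) w)
                (trans (act-cong t (λ w → sym (act-stepPoly-zero (cdSum k) w)) w)
                       (sym (act-stepPoly-suc 0 (cdSum k) w))) ⟩
         α ℤ.- β ℤ.+ δ ∎) ⟩
  α ℤ.- β ℤ.+ δ ℤ.+ (β ℤ.+ (β ℤ.+ (γ ℤ.+ (β ℤ.+ 0ℤ))))
    ≡⟨ collect α β γ δ ⟩
  α ℤ.+ β ℤ.+ (δ ℤ.+ γ) ℤ.+ β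
    ≡⟨ cong (ℤ._+ β) (cong₂ ℤ._+_ (act-c (cdSum (suc k)) w) (cd-split (cdSum k) w)) ⟨
  cdSum (suc (suc k)) w ℤ.+ β ∎
  where
  t = var a -ₚ var b
  α = (a ◂ cdSum (suc k)) w
  β = (b ◂ cdSum (suc k)) w
  γ = (b ◂ act (expandCD c) (cdSum k)) w
  δ = act (stepPoly 1) (cdSum k) w
  collect : ∀ α β γ δ →
    α ℤ.- β ℤ.+ δ ℤ.+ (β ℤ.+ (β ℤ.+ (γ ℤ.+ (β ℤ.+ 0ℤ)))) ≡
    α ℤ.+ β ℤ.+ (δ ℤ.+ γ) ℤ.+ β
  collect = solve-∀

-- By d = tb + bc, the difference F_{k+1} - cF_k is bΨ₃(k + 1) + tbΨ₂(k), both terms being zero at k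
-- = 0. These are terms missing from row 3 of the recursion.
cdSum-suc : ∀ k w → cdSum (suc k) w ≡
  act (expandCD c) (cdSum k) w ℤ.+
  act (stepPoly 0) (abSeries (suc (suc zero)) (suc k)) w ℤ.+
  act (stepPoly 1) (abSeries (suc zero) k) w
cdSum-suc zero w = sym (trans
  (cong₂ (λ p q → act (expandCD c) (cdSum 0) w ℤ.+ p ℤ.+ q)
         (act-zero (stepPoly 0) (λ _ → refl) w)
         (act-zero (stepPoly 1) (λ _ → refl) w))
  (trans (ℤ.+-identityʳ _) (ℤ.+-identityʳ _)))
cdSum-suc (suc k) w = begin
  act (expandCD c) (cdSum (suc k)) w ℤ.+ act (expandCD d) (cdSum k) w
    ≡⟨ cong (ℤ._+_ γ) (cd-split (cdSum k) w) ⟩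
  γ ℤ.+ (act (stepPoly 1) (cdSum k) w ℤ.+ (b ◂ act (expandCD c) (cdSum k)) w)
    ≡⟨ cong (λ p → γ ℤ.+ (act (stepPoly 1) (cdSum k) w ℤ.+ p))
            (act-stepPoly-zero (act (expandCD c) (cdSum k)) w) ⟨
  γ ℤ.+ (act (stepPoly 1) (cdSum k) w ℤ.+ act (stepPoly 0) (act (expandCD c) (cdSum k)) w)
    ≡⟨ rotate γ _ _ ⟩
  γ ℤ.+ act (stepPoly 0) (act (expandCD c) (cdSum k)) w ℤ.+ act (stepPoly 1) (cdSum k) w ∎
  where
  γ = act (expandCD c) (cdSum (suc k)) w
  rotate : ∀ p q r → p ℤ.+ (q ℤ.+ r) ≡ p ℤ.+ r ℤ.+ q
  rotate = solve-∀

-- Beyond distance 1, the sum is the saturated value F_{k+1} + bF_k less the terms at zero entries.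
-- Rows 1, 2 and 4 lose bF_k, from one zero of B₁. Row 3 loses bF_k and bΨ₃(k + 1) from B₁ and
-- tbΨ₂(k) from B₂, which leaves cF_k by `cdSum-suc`.
abSeries-suc : ∀ u k w → abSeries u (suc k) w ≡
  when (reach? M (suc k) u zero) (coeff (a-b^ k) w) ℤ.+
  ∑ (allFin 4) λ v → ∑ (upTo (suc k)) λ j →
    when (reach? M (suc j) u v) (act (stepPoly j) (abSeries v (k ∸ j)) w)
abSeries-suc u zero w = sym (trans
  (cong (ℤ._+_ (when (reach? M 1 u zero) (coeff 1ₚ w)))
    (∑-zero (allFin 4)
            {λ v → when (reach? M 1 u v) (act (stepPoly 0) (abSeries v 0) w) ℤ.+ 0ℤ}
            λ v → cong (ℤ._+ 0ℤ) (trans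
              (cong (when (reach? M 1 u v)) (act-zero (stepPoly 0) (λ _ → refl) w))
              (when-zero (reach? M 1 u v)))))
  (trans (ℤ.+-identityʳ _) (first u)))
  where
  -- The first column of `M` is zero only in row 3, where Ψ₃(1) = 0.
  first : ∀ u → when (reach? M 1 u zero) (coeff 1ₚ w) ≡ abSeries u 1 w
  first zero                   = refl
  first (suc zero)             = refl
  first (suc (suc zero))       = refl
  first (suc (suc (suc zero))) = refl
abSeries-suc u (suc k) w = sym (begin
  when (reach? M (2 ℕ.+ k) u zero) x ℤ.+
  ∑ (allFin 4) (λ v → ∑ (upTo (2 ℕ.+ k)) (entry u v))
    ≡⟨ cong₂ ℤ._+_ (when-true (reach? M (2 ℕ.+ k) u zero) (reach-2+-zero k u))
                   (∑-swap (allFin 4) (upTo (2 ℕ.+ k)) (entry u)) ⟩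
  x ℤ.+ ∑ (upTo (2 ℕ.+ k)) (steps u)
    ≡⟨ cong (ℤ._+_ x) (peel (steps u)) ⟩
  x ℤ.+ (steps u 0 ℤ.+ (steps u 1 ℤ.+ ∑ (upTo k) (λ j → steps u (2 ℕ.+ j))))
    ≡⟨ cong (λ r → x ℤ.+ (steps u 0 ℤ.+ (steps u 1 ℤ.+ r)))
         (∑-cong (upTo k) λ j →
           ∑-cong (allFin 4) {λ v → entry u v (2 ℕ.+ j)} {λ v → entire v (2 ℕ.+ j)} λ v →
             when-true (reach? M (3 ℕ.+ j) u v) (reach-3+ j u v)) ⟩
  x ℤ.+ (steps u 0 ℤ.+ (steps u 1 ℤ.+ rest))
    ≡⟨ excess (abSeries u (suc (suc k)) w) (missing u) x
              (steps u 0) (full 0) (steps u 1) (full 1) rest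
              (balance u) (begin
                x ℤ.+ (full 0 ℤ.+ (full 1 ℤ.+ rest))     ≡⟨ cong (ℤ._+_ x) (peel full) ⟨
                x ℤ.+ ∑ (upTo (2 ℕ.+ k)) full            ≡⟨ saturated-closed k w ⟩
                cdSum (suc k) w ℤ.+ (b ◂ cdSum k) w      ≡⟨ cong (ℤ._+_ (cdSum (suc k) w))
                                                              (act-stepPoly-zero (cdSum k) w) ⟨
                cdSum (suc k) w ℤ.+ p                    ≡⟨ shortfall u ⟩
                abSeries u (suc (suc k)) w ℤ.+ missing u ∎) ⟩
  abSeries u (suc (suc k)) w ∎)
  where
  x = coeff (a-b^ (suc k)) w

  entire : Fin 4 → ℕ → ℤ
  entire v j = act (stepPoly j) (abSeries v (suc k ∸ j)) w

  full : ℕ → ℤ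
  full j = ∑ (allFin 4) λ v → entire v j

  entry : Fin 4 → Fin 4 → ℕ → ℤ
  entry u v j = when (reach? M (suc j) u v) (entire v j)

  steps : Fin 4 → ℕ → ℤ
  steps u j = ∑ (allFin 4) λ v → entry u v j

  rest = ∑ (upTo k) λ j → full (2 ℕ.+ j)

  peel : ∀ f → ∑ (upTo (2 ℕ.+ k)) f ≡ f 0 ℤ.+ (f 1 ℤ.+ ∑ (upTo k) (λ j → f (2 ℕ.+ j)))
  peel f = trans (∑-upTo-suc (suc k) f) (cong (ℤ._+_ (f 0)) (∑-upTo-suc k (f ∘ suc)))

  p  = act (stepPoly 0) (cdSum k) w
  p₃ = act (stepPoly 0) (abSeries (suc (suc zero)) (suc k)) w
  q₂ = act (stepPoly 1) (abSeries (suc zero) k) w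

  -- The terms of the saturated sum at the zero entries of M and M².
  missing : Fin 4 → ℤ
  missing (suc (suc zero)) = p ℤ.+ p₃ ℤ.+ q₂
  missing _                = p

  balance : ∀ u → full 0 ℤ.+ full 1 ≡ steps u 0 ℤ.+ steps u 1 ℤ.+ missing u
  balance zero = lemma p p₃ (full 1)
    where
    lemma : ∀ p r f → (p ℤ.+ (p ℤ.+ (r ℤ.+ (p ℤ.+ 0ℤ)))) ℤ.+ f ≡
            (p ℤ.+ (p ℤ.+ (r ℤ.+ (0ℤ ℤ.+ 0ℤ)))) ℤ.+ f ℤ.+ p
    lemma = solve-∀
  balance (suc zero) = lemma p p₃ (full 1)
    where
    lemma : ∀ p r f → (p ℤ.+ (p ℤ.+ (r ℤ.+ (p ℤ.+ 0ℤ)))) ℤ.+ f ≡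
            (p ℤ.+ (0ℤ ℤ.+ (r ℤ.+ (p ℤ.+ 0ℤ)))) ℤ.+ f ℤ.+ p
    lemma = solve-∀
  balance (suc (suc zero)) = lemma p p₃ (entire zero 1) q₂
    (entire (suc (suc zero)) 1) (entire (suc (suc (suc zero))) 1)
    where
    lemma : ∀ p r q₁ q₂ q₃ q₄ →
      (p ℤ.+ (p ℤ.+ (r ℤ.+ (p ℤ.+ 0ℤ)))) ℤ.+ (q₁ ℤ.+ (q₂ ℤ.+ (q₃ ℤ.+ (q₄ ℤ.+ 0ℤ)))) ≡
      (0ℤ ℤ.+ (p ℤ.+ (0ℤ ℤ.+ (p ℤ.+ 0ℤ)))) ℤ.+ (q₁ ℤ.+ (0ℤ ℤ.+ (q₃ ℤ.+ (q₄ ℤ.+ 0ℤ)))) ℤ.+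
      (p ℤ.+ r ℤ.+ q₂)
    lemma = solve-∀
  -- Rows 2 and 4 of `M` coincide, hence so do those of its square.
  balance (suc (suc (suc zero))) = balance (suc zero)

  shortfall : ∀ u → cdSum (suc k) w ℤ.+ p ≡ abSeries u (suc (suc k)) w ℤ.+ missing u
  shortfall zero                   = refl
  shortfall (suc zero)             = refl
  shortfall (suc (suc zero))       = trans (cong (ℤ._+ p) (cdSum-suc k w))
                                       (lemma (act (expandCD c) (cdSum k) w) p p₃ q₂)
    where
    lemma : ∀ y p r q → y ℤ.+ r ℤ.+ q ℤ.+ p ≡ y ℤ.+ (p ℤ.+ r ℤ.+ q)
    lemma = solve-∀
  shortfall (suc (suc (suc zero))) = refl

  excess : ∀ y m x g₀ f₀ g₁ f₁ r → f₀ ℤ.+ f₁ ≡ g₀ ℤ.+ g₁ ℤ.+ m →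
           x ℤ.+ (f₀ ℤ.+ (f₁ ℤ.+ r)) ≡ y ℤ.+ m → x ℤ.+ (g₀ ℤ.+ (g₁ ℤ.+ r)) ≡ y
  excess y m x g₀ f₀ g₁ f₁ r f≡g+m eq = begin
    x ℤ.+ (g₀ ℤ.+ (g₁ ℤ.+ r))               ≡⟨ add x g₀ g₁ r m ⟩
    x ℤ.+ (g₀ ℤ.+ g₁ ℤ.+ m ℤ.+ r) ℤ.- m     ≡⟨ cong (λ s → x ℤ.+ (s ℤ.+ r) ℤ.- m) f≡g+m ⟨
    x ℤ.+ (f₀ ℤ.+ f₁ ℤ.+ r) ℤ.- m           ≡⟨ cong (λ s → x ℤ.+ s ℤ.- m) (ℤ.+-assoc f₀ f₁ r) ⟩
    x ℤ.+ (f₀ ℤ.+ (f₁ ℤ.+ r)) ℤ.- m         ≡⟨ cong (ℤ._- m) eq ⟩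
    y ℤ.+ m ℤ.- m                           ≡⟨ drop y m ⟩
    y                                       ∎
    where
    add : ∀ x g₀ g₁ r m → x ℤ.+ (g₀ ℤ.+ (g₁ ℤ.+ r)) ≡ x ℤ.+ (g₀ ℤ.+ g₁ ℤ.+ m ℤ.+ r) ℤ.- m
    add = solve-∀
    drop : ∀ y m → y ℤ.+ m ℤ.- m ≡ y
    drop = solve-∀

-- At positive distance only vertex 3 at distance 1 fails to reach vertex 1, and at distance 0 the
-- series is zero throughout.
abSeries-unreachable : ∀ u k → ¬ Reach M k u zero → ∀ w → abSeries u k w ≡ 0ℤ
abSeries-unreachable u                      zero          ¬r w = refl
abSeries-unreachable zero                   (suc zero)    ¬r w = contradiction ℕ.z<s ¬r
abSeries-unreachable (suc zero)             (suc zero)    ¬r w = contradiction ℕ.z<s ¬r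
abSeries-unreachable (suc (suc zero))       (suc zero)    ¬r w = refl
abSeries-unreachable (suc (suc (suc zero))) (suc zero)    ¬r w = contradiction ℕ.z<s ¬r
abSeries-unreachable u                      (suc (suc k)) ¬r w =
  contradiction (reach-2+-zero k u) ¬r

corollary8p3 : P.LevelEulerian ×
    (∀ (m : ℕ) →
    IsCDIndex (P.interval bottom (top m) (bottom≤top m)) (sumOfCDMonomials m))
corollary8p3 = levelEulerian M alternatingSum≡0 , λ m w → trans
  -- Both sides equal `cdSum m`, to which `abSeries zero (suc m)` reduces.
  (coeff-sumOfCDMonomials m w)
  (sym (coeff-Ψ-interval M abSeries (λ _ _ → refl) abSeries-unreachable abSeries-suc
         zero 0ℤ m (bottom≤top m) w))
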